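{- Let $F$ be a binary format descriptor with IEEE exceptional encodings and conventional bias $b=2^{e_w-1}-1$ (where $e_w\ge 2$ is the exponent-field width and $f_w>0$ the fraction-field width). Let $\operatorname{val}_F$ be the real interpretation of encoded words, $R_F$ nearest-even rounding on the gradual-underflow grid without upper exponent bound, and $S_F^{+},S_F^{ - },S_F^{\times},S_F^{\mathrm{fma}}$ the reference addition, subtraction, multiplication and fused multiply-add on encoded words. For all encoded words $x,y,z$ of $F$: (1) if $x$, $y$ and $S_F^{+}(x,y)$ are finite, then $\operatorname{val}_F(S_F^{+}(x,y))=R_F(\operatorname{val}_F(x)+\operatorname{val}_F(y))$; (2) if $x$, $y$ and $S_F^{ - }(x,y)$ are finite, then $\operatorname{val}_F(S_F^{ - }(x,y))=R_F(\operatorname{val}_F(x)-\operatorname{val}_F(y))$; (3) if $x$, $y$ and $S_F^{\times}(x,y)$ are finite, then $\operatorname{val}_F(S_F^{\times}(x,y))=R_F(\operatorname{val}_F(x)\operatorname{val}_F(y))$; (4) if $x$, $y$, $z$ and $S_F^{\mathrm{fma}}(x,y,z)$ are finite, then $\operatorname{val}_F(S_F^{\mathrm{fma}}(x,y,z))=R_F(\operatorname{val}_F(x)\operatorname{val}_F(y)+\operatorname{val}_F(z))$.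
   Context: Encoded words. A word of $F$ is a bit vector of width $1+e_w+f_w$, split into a sign bit $s$, an exponent field $E\in[0,2^{e_w})$ and a fraction field $M\in[0,2^{f_w})$. With IEEE exceptional encodings: if $E=2^{e_w}-1$ the word is an infinity (when $M=0$) or a NaN (when $M\ne0$); every other word is finite. A finite word decodes to the signed dyadic $(-1)^s m2^{q}$ with $(m,q)=(M,\,1-b-f_w)$ if $E=0$ and $(m,q)=(2^{f_w}+M,\;E-b-f_w)$ if $E\ge1$; the Boolean sign $s$ is retained even if $m=0$, so there are two zeros. The real interpretation $\operatorname{val}_F(w)\in\mathbb{R}$ is the real number $(-1)^sm2^q$ for finite $w$ (forgetting the sign of zero), and is $0$ for nonfinite $w$. Packing. For a signed dyadic $d=(-1)^s m2^q$ ($m\in\mathbb{N}$, $q\in\mathbb{Z}$), $\operatorname{roundDyadic}_F(d)$ is the word obtained by rounding once to nearest-even and packing: - if $m=0$, the zero with sign $s$; - otherwise let $\lambda=\lfloor\log_2 m\rfloor+q$. If $\lambda<1-b$ (subnormal range), let $k$ be $m2^{q-(1-b-f_w)}$ rounded to the nearest integer, ties to even; the result has sign $s$ and fields $(E,M)=(0,k)$ if $k<2^{f_w}$ and $(1,0)$ if $k=2^{f_w}$. - If $\lambda\ge 1-b$, let $k\in[2^{f_w},2^{f_w+1}]$ be $m2^{q-(\lambda-f_w)}$ rounded to the nearest integer, ties to even; if $k=2^{f_w+1}$, replace $(k,\lambda)$ by $(2^{f_w},\lambda+1)$. If then $\lambda>b$, the result is the infinity of sign $s$; otherwise it has sign $s$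 and fields $(E,M)=(\lambda+b,\;k-2^{f_w})$. Reference operations. On finite operands, each reference operation computes the exact dyadic sum, difference, product, or (for fused multiply-add) product-plus-addend $xy+z$, and applies $\operatorname{roundDyadic}_F$ once. (The sign chosen for an exact zero result follows the IEEE 754 rules and does not affect $\operatorname{val}_F$; operations with nonfinite operands follow IEEE 754 exceptional rules and are not concerned here.) Real rounding. Put $P=f_w+1$, $e_{\min}=1-b-f_w$. For real $x\ne0$ let $e\in\mathbb{Z}$ satisfy $2^{e-1}\le|x|<2^e$ and set $c(x)=\max(e-P,e_{\min})$; $R_F(x)=\operatorname{rnd}(x2^{ -c(x)})2^{c(x)}$, where $\operatorname{rnd}$ is nearest-integer rounding with ties to even, and $R_F(0)=0$. -}

module Defs where

open import Data.Bool using (Bool; true; false; not; _∧_; _xor_; if_then_else_)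
open import Data.Empty using (⊥-elim)
open import Data.Integer as ℤ using (ℤ; +_; -[1+_]; +[1+_])
import Data.Integer.Properties as ℤP
open import Data.Nat as ℕ using (ℕ; zero; suc; NonZero)
import Data.Nat.Properties as ℕP
open import Data.Nat.Coprimality using (Coprime)
open import Data.Nat.Divisibility using (_∣?_)
open import Data.Nat.Logarithm using (⌊log₂_⌋)
open import Data.Product using (∃; _×_; _,_; proj₁)
open import Data.Rational as ℚ using (ℚ; mkℚ; 0ℚ; 1ℚ; ½; toℚᵘ)
import Data.Rational.Properties as ℚP
import Data.Rational.Unnormalised as ℚᵘ
import Data.Rational.Unnormalised.Properties as ℚᵘP
open import Data.Vec using (Vec; []; _∷_; _++_; head; tail; take; drop)
open import Algebra.Definitions.RawSemiring ℚ.+-*-rawSemiring using (_^_)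
open import Algebra.Bundles using (CommutativeMonoid)
open import Algebra.Properties.CommutativeSemigroup
  (CommutativeMonoid.commutativeSemigroup ℚP.*-1-commutativeMonoid) using (interchange)
open import Relation.Binary.Definitions using (tri<; tri≈; tri>)
open import Relation.Binary.PropositionalEquality
  using (_≡_; _≢_; refl; sym; trans; cong; subst)
open import Relation.Nullary using (yes; no; does)

-- Every number involved is a dyadic rational, so the real line is
-- represented by ℚ.

2ℚ : ℚ
2ℚ = + 2 ℚ./ 1

infix 8 2^_

2^_ : ℤ → ℚ
2^ (+ n)    = 2ℚ ^ n
2^ -[1+ n ] = ½ ^ suc n

rnd : ℚ → ℤ
rnd x with ℚP.<-cmp (x ℚ.- ℚ.floor x ℚ./ 1) ½
... | tri< _ _ _ = ℚ.floor x
... | tri> _ _ _ = ℚ.floor x ℤ.+ + 1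
... | tri≈ _ _ _ with 2 ∣? ℤ.∣ ℚ.floor x ∣
...   | yes _ = ℚ.floor x
...   | no  _ = ℚ.floor x ℤ.+ + 1

private
  2^n>0 : ∀ n → NonZero (2 ℕ.^ n)
  2^n>0 n = ℕP.m^n≢0 2 n

  n<2^n : ∀ n → n ℕ.< 2 ℕ.^ n
  n<2^n zero    = ℕ.s≤s ℕ.z≤n
  n<2^n (suc n) = begin-strict
    suc n                       ≤⟨ n<2^n n ⟩
    2 ℕ.^ n                     <⟨ ℕP.m<m+n (2 ℕ.^ n) (ℕ.>-nonZero⁻¹ _ {{2^n>0 n}}) ⟩
    2 ℕ.^ n ℕ.+ 2 ℕ.^ n         ≡⟨ cong (2 ℕ.^ n ℕ.+_) (sym (ℕP.+-identityʳ _)) ⟩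
    2 ℕ.^ suc n                 ∎
    where open ℕP.≤-Reasoning

  2ℚ^ : ∀ n → toℚᵘ (2ℚ ^ n) ℚᵘ.≃ + (2 ℕ.^ n) ℚᵘ./ 1
  2ℚ^ zero    = ℚᵘP.≃-refl
  2ℚ^ (suc n) = begin
    toℚᵘ (2ℚ ℚ.* 2ℚ ^ n)                      ≈⟨ ℚP.toℚᵘ-homo-* 2ℚ (2ℚ ^ n) ⟩
    toℚᵘ 2ℚ ℚᵘ.* toℚᵘ (2ℚ ^ n)                ≈⟨ ℚᵘP.*-congˡ {toℚᵘ 2ℚ} (2ℚ^ n) ⟩
    toℚᵘ 2ℚ ℚᵘ.* (+ (2 ℕ.^ n) ℚᵘ./ 1)         ≈⟨ ℚᵘ.*≡* (cong (ℤ._* + 1) (sym (ℤP.pos-* 2 (2 ℕ.^ n)))) ⟩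
    + (2 ℕ.^ suc n) ℚᵘ./ 1                    ∎
    where open ℚᵘP.≃-Reasoning

  ½^ : ∀ n → toℚᵘ (½ ^ n) ℚᵘ.* (+ (2 ℕ.^ n) ℚᵘ./ 1) ℚᵘ.≃ ℚᵘ.1ℚᵘ
  ½^ n = begin
    toℚᵘ (½ ^ n) ℚᵘ.* (+ (2 ℕ.^ n) ℚᵘ./ 1)  ≈⟨ ℚᵘP.*-congˡ {toℚᵘ (½ ^ n)} (ℚᵘP.≃-sym (2ℚ^ n)) ⟩
    toℚᵘ (½ ^ n) ℚᵘ.* toℚᵘ (2ℚ ^ n)         ≈⟨ ℚᵘP.≃-sym (ℚP.toℚᵘ-homo-* (½ ^ n) (2ℚ ^ n)) ⟩
    toℚᵘ (½ ^ n ℚ.* 2ℚ ^ n)                 ≡⟨ cong toℚᵘ (inv n) ⟩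
    ℚᵘ.1ℚᵘ                                  ∎
    where
    open ℚᵘP.≃-Reasoning
    inv : ∀ n → ½ ^ n ℚ.* 2ℚ ^ n ≡ 1ℚ
    inv zero    = refl
    inv (suc n) = trans (interchange ½ (½ ^ n) 2ℚ (2ℚ ^ n)) (cong (1ℚ ℚ.*_) (inv n))

  search : ∀ a i k → 2^ i ℚ.≤ a → a ℚ.< 2^ (i ℤ.+ + k) →
           ∃ λ e → 2^ (e ℤ.- + 1) ℚ.≤ a × a ℚ.< 2^ e
  search a i zero lo hi = ⊥-elim (ℚP.<-irrefl refl
    (ℚP.≤-<-trans lo (subst (λ j → a ℚ.< 2^ j) (ℤP.+-identityʳ i) hi)))
  search a i (suc k) lo hi with a ℚP.<? 2^ (i ℤ.+ + k)
  ... | yes a<  = search a i k lo a<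
  ... | no  a≮  = i ℤ.+ + suc k
                , subst (λ j → 2^ j ℚ.≤ a) (sym (ℤP.+-assoc i (+ suc k) (ℤ.- + 1))) (ℚP.≮⇒≥ a≮)
                , hi

  upper : ∀ n d .(c : Coprime n (suc d)) → mkℚ (+ n) d c ℚ.< 2^ (+ n)
  upper n d c = ℚP.toℚᵘ-cancel-< {mkℚ (+ n) d c} {2^ (+ n)}
    (ℚᵘP.<-respʳ-≃ (ℚᵘP.≃-sym (2ℚ^ n)) (ℚᵘ.*<* lt))
    where
    lt : + n ℤ.* + 1 ℤ.< + (2 ℕ.^ n) ℤ.* + suc d
    lt = begin-strict
      + n ℤ.* + 1               ≡⟨ ℤP.*-identityʳ (+ n) ⟩
      + n                       <⟨ ℤ.+<+ (ℕP.<-≤-trans (n<2^n n) (ℕP.m≤m*n (2 ℕ.^ n) (suc d))) ⟩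
      + (2 ℕ.^ n ℕ.* suc d)     ≡⟨ ℤP.pos-* (2 ℕ.^ n) (suc d) ⟩
      + (2 ℕ.^ n) ℤ.* + suc d   ∎
      where open ℤP.≤-Reasoning

  lower : ∀ n d .(c : Coprime (suc n) (suc d)) → 2^ -[1+ d ] ℚ.≤ mkℚ +[1+ n ] d c
  lower n d c = ℚP.toℚᵘ-cancel-≤ {2^ -[1+ d ]} {mkℚ +[1+ n ] d c}
    (ℚᵘP.*-cancelʳ-≤-pos (+ (2 ℕ.^ suc d) ℚᵘ./ 1) {{ℚᵘ.positive 0<}}
      (ℚᵘP.≤-respˡ-≃ (ℚᵘP.≃-sym (½^ (suc d))) (ℚᵘ.*≤* le)))
    where
    0< : ℚᵘ.0ℚᵘ ℚᵘ.< + (2 ℕ.^ suc d) ℚᵘ./ 1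
    0< = ℚᵘ.*<* (subst (+ 0 ℤ.<_) (sym (ℤP.*-identityʳ _))
           (ℤ.+<+ (ℕ.>-nonZero⁻¹ _ {{2^n>0 (suc d)}})))
    le : + 1 ℤ.* + (suc d ℕ.* 1) ℤ.≤ (+[1+ n ] ℤ.* + (2 ℕ.^ suc d)) ℤ.* + 1
    le = begin
      + 1 ℤ.* + (suc d ℕ.* 1)                ≡⟨ ℤP.*-identityˡ (+ (suc d ℕ.* 1)) ⟩
      + (suc d ℕ.* 1)                        ≡⟨ cong +_ (ℕP.*-identityʳ (suc d)) ⟩
      + suc d                                ≤⟨ ℤ.+≤+ (ℕP.<⇒≤ (n<2^n (suc d))) ⟩
      + (2 ℕ.^ suc d)                        ≤⟨ ℤ.+≤+ (ℕP.m≤n*m (2 ℕ.^ suc d) (suc n)) ⟩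
      + (suc n ℕ.* 2 ℕ.^ suc d)              ≡⟨ ℤP.pos-* (suc n) (2 ℕ.^ suc d) ⟩
      +[1+ n ] ℤ.* + (2 ℕ.^ suc d)           ≡⟨ ℤP.*-identityʳ (+[1+ n ] ℤ.* + (2 ℕ.^ suc d)) ⟨
      (+[1+ n ] ℤ.* + (2 ℕ.^ suc d)) ℤ.* + 1 ∎
      where open ℤP.≤-Reasoning

  bracket : ∀ n d .(c : Coprime (suc n) (suc d)) → let a = mkℚ +[1+ n ] d c in
            ∃ λ e → 2^ (e ℤ.- + 1) ℚ.≤ a × a ℚ.< 2^ e
  bracket n d c = search (mkℚ +[1+ n ] d c) -[1+ d ] (suc d ℕ.+ suc n) (lower n d c)
    (subst (λ j → mkℚ +[1+ n ] d c ℚ.< 2^ j) (sym eq) (upper (suc n) d c))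
    where
    eq : -[1+ d ] ℤ.+ + (suc d ℕ.+ suc n) ≡ + suc n
    eq = trans (cong (λ j → -[1+ d ] ℤ.+ j) (ℤP.pos-+ (suc d) (suc n)))
           (trans (sym (ℤP.+-assoc -[1+ d ] (+ suc d) (+ suc n)))
             (trans (cong (λ j → j ℤ.+ + suc n) (ℤP.+-inverseˡ (+ suc d))) (ℤP.+-identityˡ _)))

binaryExponent : ∀ x → x ≢ 0ℚ → ∃ λ e → 2^ (e ℤ.- + 1) ℚ.≤ ℚ.∣ x ∣ × ℚ.∣ x ∣ ℚ.< 2^ e
binaryExponent (mkℚ +[1+ n ] d c) _   = bracket n d c
binaryExponent (mkℚ -[1+ n ] d c) _   = bracket n d c
binaryExponent x@(mkℚ (+ 0) _ _)  x≢0 = ⊥-elim (x≢0 (ℚP.↥p≡0⇒p≡0 x refl))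

signed : Bool → ℕ → ℤ
signed false m = + m
signed true  m = ℤ.- + m

-- The sign is kept when the significand is 0, so there are two zeros.
record Dyadic : Set where
  constructor dyadic
  field
    sign        : Bool
    significand : ℕ
    exponent    : ℤ

⟦_⟧ : Dyadic → ℚ
⟦ dyadic s m q ⟧ = (signed s m ℚ./ 1) ℚ.* 2^ q

signBit : ℤ → Bool → Bool
signBit (+ 0)    s₀ = s₀
signBit +[1+ _ ] _  = false
signBit -[1+ _ ] _  = true

-- An exact zero sum is negative only when both operands are (negative zeros),
-- as IEEE 754 prescribes under rounding to nearest.
_+ᵈ_ : Dyadic → Dyadic → Dyadic
dyadic s₁ m₁ q₁ +ᵈ dyadic s₂ m₂ q₂ = dyadic (signBit n (s₁ ∧ s₂)) ℤ.∣ n ∣ q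
  where
  q : ℤ
  q = q₁ ℤ.⊓ q₂
  n : ℤ
  n = signed s₁ (m₁ ℕ.* 2 ℕ.^ ℤ.∣ q₁ ℤ.- q ∣) ℤ.+ signed s₂ (m₂ ℕ.* 2 ℕ.^ ℤ.∣ q₂ ℤ.- q ∣)

-ᵈ_ : Dyadic → Dyadic
-ᵈ dyadic s m q = dyadic (not s) m q

_*ᵈ_ : Dyadic → Dyadic → Dyadic
dyadic s₁ m₁ q₁ *ᵈ dyadic s₂ m₂ q₂ = dyadic (s₁ xor s₂) (m₁ ℕ.* m₂) (q₁ ℤ.+ q₂)

data Datum : Set where
  finite : Dyadic → Datum
  inf    : Bool → Datum
  nan    : Datum

infixl 6 _⊕_
infixl 7 _⊗_

_⊕_ : Datum → Datum → Datum
nan      ⊕ _        = nan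
finite _ ⊕ nan      = nan
inf _    ⊕ nan      = nan
finite d ⊕ finite e = finite (d +ᵈ e)
finite _ ⊕ inf s    = inf s
inf s    ⊕ finite _ = inf s
inf s    ⊕ inf t    = if s xor t then nan else inf s

⊖_ : Datum → Datum
⊖ finite d = finite (-ᵈ d)
⊖ inf s    = inf (not s)
⊖ nan      = nan

inf* : Bool → Dyadic → Datum
inf* s (dyadic _ zero    _) = nan
inf* s (dyadic t (suc _) _) = inf (s xor t)

_⊗_ : Datum → Datum → Datum
nan      ⊗ _        = nan
finite _ ⊗ nan      = nan
inf _    ⊗ nan      = nan
finite d ⊗ finite e = finite (d *ᵈ e)
finite d ⊗ inf s    = inf* s d
inf s    ⊗ finite d = inf* s d
inf s    ⊗ inf t    = inf (s xor t)

-- Most significant bit first.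
fromBits : ∀ {n} → Vec Bool n → ℕ
fromBits             []          = 0
fromBits {n = suc n} (false ∷ v) = fromBits v
fromBits {n = suc n} (true  ∷ v) = 2 ℕ.^ n ℕ.+ fromBits v

-- Bits above the n low-order ones are discarded.
toBits : ∀ n → ℕ → Vec Bool n
toBits zero    k = []
toBits (suc n) k = (((k ℕ./ 2 ℕ.^ n) {{ℕP.m^n≢0 2 n}} ℕ.% 2) ℕ.≡ᵇ 1) ∷ toBits n k

record Format : Set where
  field
    eʷ   : ℕ
    fʷ   : ℕ
    2≤eʷ : 2 ℕ.≤ eʷ
    0<fʷ : 0 ℕ.< fʷ

  bias : ℤ
  bias = + (2 ℕ.^ (eʷ ℕ.∸ 1)) ℤ.- + 1

  precision : ℕ
  precision = fʷ ℕ.+ 1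

  eₘᵢₙ : ℤ
  eₘᵢₙ = + 1 ℤ.- bias ℤ.- + fʷ

  maxField : ℕ
  maxField = 2 ℕ.^ eʷ ℕ.∸ 1

module _ (F : Format) where
  open Format F

  Word : Set
  Word = Vec Bool (1 ℕ.+ eʷ ℕ.+ fʷ)

  signField : Word → Bool
  signField w = head w

  exponentField : Word → ℕ
  exponentField w = fromBits (take eʷ (tail w))

  fractionField : Word → ℕ
  fractionField w = fromBits (drop eʷ (tail w))

  pack : Bool → ℕ → ℕ → Word
  pack s E M = s ∷ (toBits eʷ E ++ toBits fʷ M)

  Finite : Word → Set
  Finite w = exponentField w ≢ maxField

  decodeFinite : Bool → ℕ → ℕ → Dyadic
  decodeFinite s zero      M = dyadic s M eₘᵢₙ
  decodeFinite s E@(suc _) M = dyadic s (2 ℕ.^ fʷ ℕ.+ M) (+ E ℤ.- bias ℤ.- + fʷ)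

  decode : Word → Datum
  decode w with exponentField w ℕ.≟ maxField
  ... | no _  = finite (decodeFinite (signField w) (exponentField w) (fractionField w))
  ... | yes _ with fractionField w ℕ.≟ 0
  ...   | yes _ = inf (signField w)
  ...   | no _  = nan

  val : Word → ℚ
  val w with decode w
  ... | finite d = ⟦ d ⟧
  ... | inf _    = 0ℚ
  ... | nan      = 0ℚ

  infinity : Bool → Word
  infinity s = pack s maxField 0

  -- IEEE 754 leaves the payload open; this is the usual default quiet NaN.
  quietNaN : Word
  quietNaN = pack false maxField (2 ℕ.^ (fʷ ℕ.∸ 1))

  -- m 2^(q-c) rounded to an integer; nonnegative, hence ∣_∣ is the identity.
  roundAt : ℕ → ℤ → ℤ → ℕ
  roundAt m q c = ℤ.∣ rnd ((+ m ℚ./ 1) ℚ.* 2^ (q ℤ.- c)) ∣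

  packSubnormal : Bool → ℕ → Word
  packSubnormal s k = if k ℕ.<ᵇ 2 ℕ.^ fʷ then pack s 0 k else pack s 1 0

  packNormal : Bool → ℕ → ℤ → Word
  packNormal s k l =
    if does (bias ℤ.<? l) then infinity s
    else pack s ℤ.∣ l ℤ.+ bias ∣ (k ℕ.∸ 2 ℕ.^ fʷ)

  carryNormal : Bool → ℕ → ℤ → Word
  carryNormal s k l =
    if k ℕ.≡ᵇ 2 ℕ.^ (fʷ ℕ.+ 1) then packNormal s (2 ℕ.^ fʷ) (l ℤ.+ + 1)
    else packNormal s k l

  roundDyadic : Dyadic → Word
  roundDyadic (dyadic s zero      _) = pack s 0 0
  roundDyadic (dyadic s m@(suc _) q) =
    if does (l ℤ.<? + 1 ℤ.- bias)
    then packSubnormal s (roundAt m q eₘᵢₙ)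
    else carryNormal s (roundAt m q (l ℤ.- + fʷ)) l
    where
    l : ℤ
    l = + ⌊log₂ m ⌋ ℤ.+ q

  encode : Datum → Word
  encode (finite d) = roundDyadic d
  encode (inf s)    = infinity s
  encode nan        = quietNaN

  S⁺ : Word → Word → Word
  S⁺ x y = encode (decode x ⊕ decode y)

  S⁻ : Word → Word → Word
  S⁻ x y = encode (decode x ⊕ (⊖ decode y))

  S× : Word → Word → Word
  S× x y = encode (decode x ⊗ decode y)

  Sᶠᵐᵃ : Word → Word → Word → Word
  Sᶠᵐᵃ x y z = encode ((decode x ⊗ decode y) ⊕ decode z)

  R : ℚ → ℚ
  R x with x ℚP.≟ 0ℚ
  ... | yes _  = 0ℚ
  ... | no x≢0 = (rnd (x ℚ.* 2^ (ℤ.- c)) ℚ./ 1) ℚ.* 2^ c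
    where
    c : ℤ
    c = (proj₁ (binaryExponent x x≢0) ℤ.- + precision) ℤ.⊔ eₘᵢₙ

{-# OPTIONS --safe #-}

-- Every reference operation is an exact operation on dyadics, which commutes with ⟦_⟧, followed by one
-- roundDyadic; so it is enough that the value of roundDyadic d is R ⟦ d ⟧.  With l = ⌊log₂ m⌋ + q the
-- number m 2^q lies in [2^l , 2^(l+1)), so R scales it by the exponent c = max (l − fʷ , eₘᵢₙ), and c is
-- exactly the exponent that roundDyadic uses in its subnormal and in its normal branch.  Both round the
-- same scaled number: R the signed one, roundDyadic its absolute value, and rnd is odd because being a
-- nearest integer with ties to even is a symmetric condition that determines the integer.  A carry to
-- the next power of two does not change the value, and overflow is excluded by finiteness.

module Submission where

open import Defs
open import Data.Product using (_×_)
open import Data.Rational using (_+_; _-_; _*_)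
open import Relation.Binary.PropositionalEquality using (_≡_)

open import Algebra.Bundles using (CommutativeMonoid; CommutativeRing)
open import Data.Bool using (Bool; true; false; not; _∧_; _xor_; if_then_else_; T)
open import Data.Integer as ℤ using (ℤ; +_; -[1+_]; +[1+_]; _⊖_)
import Data.Integer.DivMod as ℤD
import Data.Integer.Properties as ℤP
import Data.Integer.Tactic.RingSolver as ℤS
open import Data.Nat as ℕ using (ℕ; zero; suc; NonZero)
import Data.Nat.DivMod as ℕD
open import Data.Nat.Divisibility
  using (_∣_; _∤_; _∣?_; ∣m∣n⇒∣m+n; ∣m+n∣m⇒∣n; ∣1⇒≡1; ∣-refl; _∣0)
open import Data.Nat.Induction using (<-rec)
open import Data.Nat.Logarithm
  using (⌊log₂_⌋; ⌊log₂⌋-mono-≤; ⌊log₂⌊n/2⌋⌋≡⌊log₂n⌋∸1; ⌊log₂[2^n]⌋≡n)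
import Data.Nat.Properties as ℕP
import Data.Nat.Tactic.RingSolver as ℕS
open import Data.Product using (_,_; proj₁; proj₂)
open import Data.Rational as ℚ using (ℚ; mkℚ; 0ℚ; 1ℚ; ½; -½; toℚᵘ)
import Data.Rational.Properties as ℚP
open import Data.Rational.Solver using (module +-*-Solver)
import Data.Rational.Unnormalised as ℚᵘ
import Data.Rational.Unnormalised.Properties as ℚᵘP
open import Data.Sum using (_⊎_; inj₁; inj₂; [_,_]′)
open import Data.Unit using (tt)
open import Data.Vec using (Vec; []; _∷_; _++_; take; drop)
open import Relation.Binary.Definitions using (tri<; tri≈; tri>)
open import Relation.Binary.PropositionalEquality
  using (refl; sym; trans; cong; cong₂; subst; subst₂; module ≡-Reasoning)
open import Relation.Nullary using (Dec; yes; no; does; ¬_; contradiction)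
open import Algebra.Properties.CommutativeSemigroup
  (CommutativeMonoid.commutativeSemigroup ℚP.*-1-commutativeMonoid) using (interchange)
open import Algebra.Properties.Semiring.Exp
  (CommutativeRing.semiring ℚP.+-*-commutativeRing) using (_^_; ^-homo-*)
open +-*-Solver using (solve; _:=_; _:+_; _:-_; :-_; con)

-- The embedding of the integers into the rationals.

ι : ℤ → ℚ
ι i = i ℚ./ 1

toℚᵘ-ι : ∀ i → toℚᵘ (ι i) ℚᵘ.≃ ℚᵘ.mkℚᵘ i 0
toℚᵘ-ι i = ℚP.toℚᵘ-fromℚᵘ (ℚᵘ.mkℚᵘ i 0)

ι-+ : ∀ i j → ι (i ℤ.+ j) ≡ ι i + ι j
ι-+ i j = ℚP.toℚᵘ-injective (begin
  toℚᵘ (ι (i ℤ.+ j))                ≈⟨ toℚᵘ-ι (i ℤ.+ j) ⟩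
  ℚᵘ.mkℚᵘ (i ℤ.+ j) 0               ≈⟨ ℚᵘ.*≡* (identity i j) ⟩
  ℚᵘ.mkℚᵘ i 0 ℚᵘ.+ ℚᵘ.mkℚᵘ j 0      ≈⟨ ℚᵘP.+-cong (toℚᵘ-ι i) (toℚᵘ-ι j) ⟨
  toℚᵘ (ι i) ℚᵘ.+ toℚᵘ (ι j)        ≈⟨ ℚP.toℚᵘ-homo-+ (ι i) (ι j) ⟨
  toℚᵘ (ι i + ι j)                  ∎)
  where
  open ℚᵘP.≃-Reasoning
  identity : ∀ i j → (i ℤ.+ j) ℤ.* + 1 ≡ (i ℤ.* + 1 ℤ.+ j ℤ.* + 1) ℤ.* + 1
  identity = ℤS.solve-∀

ι-* : ∀ i j → ι (i ℤ.* j) ≡ ι i * ι j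
ι-* i j = ℚP.toℚᵘ-injective (begin
  toℚᵘ (ι (i ℤ.* j))                ≈⟨ toℚᵘ-ι (i ℤ.* j) ⟩
  ℚᵘ.mkℚᵘ i 0 ℚᵘ.* ℚᵘ.mkℚᵘ j 0      ≈⟨ ℚᵘP.*-cong (toℚᵘ-ι i) (toℚᵘ-ι j) ⟨
  toℚᵘ (ι i) ℚᵘ.* toℚᵘ (ι j)        ≈⟨ ℚP.toℚᵘ-homo-* (ι i) (ι j) ⟨
  toℚᵘ (ι i * ι j)                  ∎)
  where open ℚᵘP.≃-Reasoning

ι-neg : ∀ i → ι (ℤ.- i) ≡ ℚ.- ι i
ι-neg i = ℚP.toℚᵘ-injective (begin
  toℚᵘ (ι (ℤ.- i))                  ≈⟨ toℚᵘ-ι (ℤ.- i) ⟩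
  ℚᵘ.- ℚᵘ.mkℚᵘ i 0                  ≈⟨ ℚᵘP.-‿cong (toℚᵘ-ι i) ⟨
  ℚᵘ.- toℚᵘ (ι i)                   ≈⟨ ℚP.toℚᵘ-homo‿- (ι i) ⟨
  toℚᵘ (ℚ.- ι i)                    ∎)
  where open ℚᵘP.≃-Reasoning

ι-mono-≤ : ∀ {i j} → i ℤ.≤ j → ι i ℚ.≤ ι j
ι-mono-≤ {i} {j} i≤j = ℚP.toℚᵘ-cancel-≤
  (ℚᵘP.≤-respʳ-≃ (ℚᵘP.≃-sym (toℚᵘ-ι j)) (ℚᵘP.≤-respˡ-≃ (ℚᵘP.≃-sym (toℚᵘ-ι i))
    (ℚᵘ.*≤* (ℤP.*-monoʳ-≤-nonNeg (+ 1) i≤j))))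

ι-mono-< : ∀ {i j} → i ℤ.< j → ι i ℚ.< ι j
ι-mono-< {i} {j} i<j = ℚP.toℚᵘ-cancel-<
  (ℚᵘP.<-respʳ-≃ (ℚᵘP.≃-sym (toℚᵘ-ι j)) (ℚᵘP.<-respˡ-≃ (ℚᵘP.≃-sym (toℚᵘ-ι i))
    (ℚᵘ.*<* (ℤP.*-monoʳ-<-pos (+ 1) i<j))))

ι-cancel-≤ : ∀ {i j} → ι i ℚ.≤ ι j → i ℤ.≤ j
ι-cancel-≤ ιi≤ιj = ℤP.≮⇒≥ λ j<i → ℚP.<-irrefl refl (ℚP.<-≤-trans (ι-mono-< j<i) ιi≤ιj)

ι-nonNeg : ∀ m → ℚ.NonNegative (ι (+ m))
ι-nonNeg m = ℚ.nonNegative (ι-mono-≤ {+ 0} {+ m} (ℤ.+≤+ ℕ.z≤n))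

-- Powers of two with integer exponents.

2^-⊖ : ∀ m n → 2^ (m ⊖ n) ≡ 2ℚ ^ m * ½ ^ n
2^-⊖ m       zero    = sym (ℚP.*-identityʳ (2ℚ ^ m))
2^-⊖ zero    (suc n) = sym (ℚP.*-identityˡ (½ ^ suc n))
2^-⊖ (suc m) (suc n) = begin
  2^ (suc m ⊖ suc n)                  ≡⟨ cong 2^_ (ℤP.[1+m]⊖[1+n]≡m⊖n m n) ⟩
  2^ (m ⊖ n)                          ≡⟨ 2^-⊖ m n ⟩
  2ℚ ^ m * ½ ^ n                      ≡⟨ ℚP.*-identityˡ (2ℚ ^ m * ½ ^ n) ⟨
  2ℚ * ½ * (2ℚ ^ m * ½ ^ n)           ≡⟨ interchange 2ℚ ½ (2ℚ ^ m) (½ ^ n) ⟩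
  2ℚ * 2ℚ ^ m * (½ * ½ ^ n)           ∎
  where open ≡-Reasoning

-- For exponents of opposite signs, integer addition computes to a difference `_⊖_` of naturals, and
-- `2^-⊖` cancels the common factors `2ℚ * ½`.
2^-homo-* : ∀ i j → 2^ (i ℤ.+ j) ≡ 2^ i * 2^ j
2^-homo-* (+ m)    (+ n)    = ^-homo-* 2ℚ m n
2^-homo-* (+ m)    -[1+ n ] = 2^-⊖ m (suc n)
2^-homo-* -[1+ m ] (+ n)    = trans (2^-⊖ n (suc m)) (ℚP.*-comm (2ℚ ^ n) (½ ^ suc m))
2^-homo-* -[1+ m ] -[1+ n ] =
  trans (cong (λ k → ½ ^ suc k) (sym (ℕP.+-suc m n))) (^-homo-* ½ (suc m) (suc n))

2^-ι : ∀ n → 2^ (+ n) ≡ ι (+ (2 ℕ.^ n))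
2^-ι zero    = refl
2^-ι (suc n) = begin
  2ℚ * 2ℚ ^ n                  ≡⟨ cong (2ℚ *_) (2^-ι n) ⟩
  2ℚ * ι (+ (2 ℕ.^ n))         ≡⟨ ι-* (+ 2) (+ (2 ℕ.^ n)) ⟨
  ι (+ 2 ℤ.* + (2 ℕ.^ n))      ≡⟨ cong ι (ℤP.pos-* 2 (2 ℕ.^ n)) ⟨
  ι (+ (2 ℕ.^ suc n))          ∎
  where open ≡-Reasoning

2^-pos : ∀ i → ℚ.Positive (2^ i)
2^-pos (+ zero)        = _
2^-pos (+ suc n)       = ℚP.pos*pos⇒pos 2ℚ (2ℚ ^ n) {{2^-pos (+ n)}}
2^-pos -[1+ zero ]     = _
2^-pos -[1+ suc n ]    = ℚP.pos*pos⇒pos ½ (½ ^ suc n) {{2^-pos -[1+ n ]}}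

i-j+j≡i : ∀ i j → i ℤ.- j ℤ.+ j ≡ i
i-j+j≡i = ℤS.solve-∀

-- The quotient `2^ (j - i)` has a natural exponent, so it is an integer power of two and at least
-- 1.
2^-mono-≤ : ∀ {i j} → i ℤ.≤ j → 2^ i ℚ.≤ 2^ j
2^-mono-≤ {i} {j} i≤j = begin
  2^ i                            ≡⟨ ℚP.*-identityˡ (2^ i) ⟨
  1ℚ * 2^ i                       ≤⟨ ℚP.*-monoʳ-≤-nonNeg (2^ i) {{ℚP.pos⇒nonNeg (2^ i) {{2^-pos i}}}}
                                       (ι-mono-≤ {+ 1} (ℤ.+≤+ (ℕP.m^n>0 2 ℤ.∣ j ℤ.- i ∣))) ⟩
  ι (+ (2 ℕ.^ ℤ.∣ j ℤ.- i ∣)) * 2^ i ≡⟨ cong (_* 2^ i) (2^-ι ℤ.∣ j ℤ.- i ∣) ⟨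
  2^ (+ ℤ.∣ j ℤ.- i ∣) * 2^ i     ≡⟨ cong (λ k → 2^ k * 2^ i) (ℤP.0≤i⇒+∣i∣≡i (ℤP.i≤j⇒0≤j-i i≤j)) ⟩
  2^ (j ℤ.- i) * 2^ i             ≡⟨ 2^-homo-* (j ℤ.- i) i ⟨
  2^ (j ℤ.- i ℤ.+ i)              ≡⟨ cong 2^_ (i-j+j≡i j i) ⟩
  2^ j                            ∎
  where open ℚP.≤-Reasoning

-- Otherwise `f ≤ e - 1`, and `a` would lie strictly below itself. Used in both directions, this
-- makes the binary exponent of a number unique, however it was found.
binaryExponent-≤ : ∀ {a} e f → 2^ (e ℤ.- + 1) ℚ.≤ a → a ℚ.< 2^ f → e ℤ.≤ f
binaryExponent-≤ {a} e f 2^e-1≤a a<2^f = ℤP.≮⇒≥ λ f<e → ℚP.<-irrefl refl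
  (ℚP.<-≤-trans a<2^f (ℚP.≤-trans (2^-mono-≤ (f≤e-1 f<e)) 2^e-1≤a))
  where
  f≤e-1 : f ℤ.< e → f ℤ.≤ e ℤ.- + 1
  f≤e-1 f<e = subst (f ℤ.≤_) (ℤP.+-comm ℤ.-1ℤ e) (ℤP.i<j⇒i≤pred[j] f<e)

-- Nearest integers with ties to even.

floor-≤ : ∀ x → ι (ℚ.floor x) ℚ.≤ x
floor-≤ x@(mkℚ n d _) = ℚP.toℚᵘ-cancel-≤
  (ℚᵘP.≤-respˡ-≃ (ℚᵘP.≃-sym (toℚᵘ-ι (n ℤ./ + suc d)))
    (ℚᵘ.*≤* (subst (n ℤ./ + suc d ℤ.* + suc d ℤ.≤_) (sym (ℤP.*-identityʳ n)) (ℤD.[n/d]*d≤n n (+ suc d)))))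

<-floor+1 : ∀ x → x ℚ.< ι (ℚ.floor x ℤ.+ + 1)
<-floor+1 x@(mkℚ n d _) = ℚP.toℚᵘ-cancel-<
  (ℚᵘP.<-respʳ-≃ (ℚᵘP.≃-sym (toℚᵘ-ι (n ℤ./ + suc d ℤ.+ + 1))) (ℚᵘ.*<* (begin-strict
    n ℤ.* + 1                                ≡⟨ ℤP.*-identityʳ n ⟩
    n                                        <⟨ ℤD.n<s[n/ℕd]*d n (suc d) ⟩
    ℤ.suc (n ℤD./ℕ suc d) ℤ.* + suc d        ≡⟨ cong (λ q → ℤ.suc q ℤ.* + suc d) (ℤD.div-pos-is-/ℕ n (suc d)) ⟨
    ℤ.suc (n ℤ./ + suc d) ℤ.* + suc d        ≡⟨ cong (ℤ._* + suc d) (ℤP.+-comm (+ 1) (n ℤ./ + suc d)) ⟩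
    (n ℤ./ + suc d ℤ.+ + 1) ℤ.* + suc d      ∎)))
  where open ℤP.≤-Reasoning

-- A characterisation of `rnd x` that avoids the floor. Unlike the floor it is symmetric: negation
-- merely exchanges the lower and the upper fields.
record IsNearestEven (x : ℚ) (n : ℤ) : Set where
  field
    lower     : -½ ℚ.≤ x - ι n
    upper     : x - ι n ℚ.≤ ½
    lower-tie : x - ι n ≡ -½ → 2 ∣ ℤ.∣ n ∣
    upper-tie : x - ι n ≡ ½ → 2 ∣ ℤ.∣ n ∣

2∣n⊎2∣1+n : ∀ n → 2 ∣ n ⊎ 2 ∣ suc n
2∣n⊎2∣1+n zero    = inj₁ (2 ∣0)
2∣n⊎2∣1+n (suc n) = [ (λ 2∣n → inj₂ (∣m∣n⇒∣m+n ∣-refl 2∣n)) , inj₁ ]′ (2∣n⊎2∣1+n n)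

2∣n⇒2∤1+n : ∀ {n} → 2 ∣ n → 2 ∤ suc n
2∣n⇒2∤1+n {n} 2∣n 2∣1+n with ∣1⇒≡1 (∣m+n∣m⇒∣n (subst (2 ∣_) (ℕP.+-comm 1 n) 2∣1+n) 2∣n)
... | ()

2∤∣i∣⇒2∣∣i+1∣ : ∀ i → 2 ∤ ℤ.∣ i ∣ → 2 ∣ ℤ.∣ i ℤ.+ + 1 ∣
2∤∣i∣⇒2∣∣i+1∣ (+ n) 2∤n = subst (2 ∣_) (ℕP.+-comm 1 n)
  ([ (λ 2∣n → contradiction 2∣n 2∤n) , (λ 2∣1+n → 2∣1+n) ]′ (2∣n⊎2∣1+n n))
-- `-[1+ n ] + 1` computes to `1 ⊖ suc n`, whose absolute value is `n`.
2∤∣i∣⇒2∣∣i+1∣ -[1+ n ] 2∤1+n = subst (2 ∣_) (sym (ℤP.∣⊖∣-≤ {1} {suc n} (ℕ.s≤s ℕ.z≤n)))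
  ([ (λ 2∣n → 2∣n) , (λ 2∣1+n → contradiction 2∣1+n 2∤1+n) ]′ (2∣n⊎2∣1+n n))

2∣∣i∣⇒2∤∣i+1∣ : ∀ i → 2 ∣ ℤ.∣ i ∣ → 2 ∤ ℤ.∣ i ℤ.+ + 1 ∣
2∣∣i∣⇒2∤∣i+1∣ (+ n)    2∣n   2∣n+1 = 2∣n⇒2∤1+n 2∣n (subst (2 ∣_) (ℕP.+-comm n 1) 2∣n+1)
2∣∣i∣⇒2∤∣i+1∣ -[1+ n ] 2∣1+n 2∣n   = 2∣n⇒2∤1+n (subst (2 ∣_) (ℤP.∣⊖∣-≤ {1} {suc n} (ℕ.s≤s ℕ.z≤n)) 2∣n) 2∣1+n

x-ι[1+i] : ∀ x i → x - ι (i ℤ.+ + 1) ≡ (x - ι i) - 1ℚ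
x-ι[1+i] x i = trans (cong (λ y → x - y) (ι-+ i (+ 1)))
  (solve 2 (λ x y → x :- (y :+ con 1ℚ) := (x :- y) :- con 1ℚ) refl x (ι i))

-- The fractional part `t` lies in [0, 1). Rounding down leaves the residue `t`, which cannot be
-- `-½`; rounding up leaves `t - 1`, which cannot be `½`. So each branch has only one possible tie,
-- namely `t ≡ ½`.
rnd-isNearestEven : ∀ x → IsNearestEven x (rnd x)
rnd-isNearestEven x = go
  where
  f : ℤ
  f = ℚ.floor x
  t : ℚ
  t = x - ι f

  0≤t : 0ℚ ℚ.≤ t
  0≤t = subst (ℚ._≤ t) (ℚP.+-inverseʳ (ι f)) (ℚP.+-monoˡ-≤ (ℚ.- ι f) (floor-≤ x))

  t-1<0 : t - 1ℚ ℚ.< 0ℚ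
  t-1<0 = subst₂ ℚ._<_ (x-ι[1+i] x f) (ℚP.+-inverseʳ (ι (f ℤ.+ + 1)))
    (ℚP.+-monoˡ-< (ℚ.- ι (f ℤ.+ + 1)) (<-floor+1 x))

  -½<0 : -½ ℚ.< 0ℚ
  -½<0 = ℚ.*<* ℤ.-<+
  0<½ : 0ℚ ℚ.< ½
  0<½ = ℚ.*<* (ℤ.+<+ (ℕ.s≤s ℕ.z≤n))

  down : t ℚ.≤ ½ → (t ≡ ½ → 2 ∣ ℤ.∣ f ∣) → IsNearestEven x f
  down t≤½ tie = record
    { lower     = ℚP.<⇒≤ -½<t
    ; upper     = t≤½
    ; lower-tie = λ t≡-½ → contradiction -½<t (ℚP.<-irrefl (sym t≡-½))
    ; upper-tie = tie
    }
    where
    -½<t : -½ ℚ.< t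
    -½<t = ℚP.<-≤-trans -½<0 0≤t

  up : ½ ℚ.≤ t → (t ≡ ½ → 2 ∣ ℤ.∣ f ℤ.+ + 1 ∣) → IsNearestEven x (f ℤ.+ + 1)
  up ½≤t tie = record
    { lower     = subst (-½ ℚ.≤_) (sym (x-ι[1+i] x f)) (ℚP.+-monoˡ-≤ (ℚ.- 1ℚ) ½≤t)
    ; upper     = ℚP.<⇒≤ <½
    ; lower-tie = λ eq → tie (begin
        t                 ≡⟨ solve 1 (λ t → t := t :- con 1ℚ :+ con 1ℚ) refl t ⟩
        t - 1ℚ + 1ℚ       ≡⟨ cong (_+ 1ℚ) (trans (sym (x-ι[1+i] x f)) eq) ⟩
        ½                 ∎)
    ; upper-tie = λ eq → contradiction <½ (ℚP.<-irrefl eq)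
    }
    where
    open ≡-Reasoning
    <½ : x - ι (f ℤ.+ + 1) ℚ.< ½
    <½ = ℚP.<-trans (subst (ℚ._< 0ℚ) (sym (x-ι[1+i] x f)) t-1<0) 0<½

  go : IsNearestEven x (rnd x)
  go with ℚP.<-cmp (x - ι (ℚ.floor x)) ½
  ... | tri< t<½ t≢½ _ = down (ℚP.<⇒≤ t<½) λ t≡½ → contradiction t≡½ t≢½
  ... | tri> _ t≢½ ½<t = up (ℚP.<⇒≤ ½<t) λ t≡½ → contradiction t≡½ t≢½
  ... | tri≈ _ t≡½ _ with 2 ∣? ℤ.∣ ℚ.floor x ∣
  ...   | yes even = down (ℚP.≤-reflexive t≡½) λ _ → even
  ...   | no  odd  = up (ℚP.≤-reflexive (sym t≡½)) λ _ → 2∤∣i∣⇒2∣∣i+1∣ f odd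

-- Both integers are within ½ of `x`, so they are at most 1 apart.
isNearestEven-≤1+ : ∀ {x m n} → IsNearestEven x m → IsNearestEven x n → m ℤ.≤ n ℤ.+ + 1
isNearestEven-≤1+ {x} {m} {n} P Q = ι-cancel-≤ {m} {n ℤ.+ + 1} (begin
  ι m                      ≡⟨ solve 2 (λ x m → m := :- (x :- m) :+ x) refl x (ι m) ⟩
  ℚ.- (x - ι m) + x        ≤⟨ ℚP.+-monoˡ-≤ x (ℚP.neg-antimono-≤ (lower P)) ⟩
  ½ + x                    ≡⟨ solve 2 (λ x n → con ½ :+ x := (x :- n) :+ (con ½ :+ n)) refl x (ι n) ⟩
  (x - ι n) + (½ + ι n)    ≤⟨ ℚP.+-monoˡ-≤ (½ + ι n) (upper Q) ⟩
  ½ + (½ + ι n)            ≡⟨ solve 1 (λ n → con ½ :+ (con ½ :+ n) := n :+ con 1ℚ) refl (ι n) ⟩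
  ι n + 1ℚ                 ≡⟨ ι-+ n (+ 1) ⟨
  ι (n ℤ.+ + 1)            ∎)
  where
  open ℚP.≤-Reasoning
  open IsNearestEven

-- Two consecutive nearest integers would put `x` exactly midway; the tie rules would then make both
-- of them even.
isNearestEven-≢1+ : ∀ {x n} → IsNearestEven x n → ¬ IsNearestEven x (n ℤ.+ + 1)
isNearestEven-≢1+ {x} {n} P Q = 2∣∣i∣⇒2∤∣i+1∣ n (upper-tie P t≡½) (lower-tie Q
    (trans (x-ι[1+i] x n) (cong (_- 1ℚ) t≡½)))
  where
  open IsNearestEven
  ½≤t : ½ ℚ.≤ x - ι n
  ½≤t = begin
    -½ + 1ℚ                       ≤⟨ ℚP.+-monoˡ-≤ 1ℚ (lower Q) ⟩
    (x - ι (n ℤ.+ + 1)) + 1ℚ      ≡⟨ cong (_+ 1ℚ) (x-ι[1+i] x n) ⟩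
    (x - ι n) - 1ℚ + 1ℚ           ≡⟨ solve 1 (λ t → t :- con 1ℚ :+ con 1ℚ := t) refl (x - ι n) ⟩
    x - ι n                       ∎
    where open ℚP.≤-Reasoning
  t≡½ : x - ι n ≡ ½
  t≡½ = ℚP.≤-antisym (upper P) ½≤t

i<j⇒i+1≤j : ∀ {i j} → i ℤ.< j → i ℤ.+ + 1 ℤ.≤ j
i<j⇒i+1≤j {i} {j} i<j = subst (ℤ._≤ j) (ℤP.+-comm (+ 1) i) (ℤP.i<j⇒suc[i]≤j i<j)

isNearestEven-unique : ∀ {x m n} → IsNearestEven x m → IsNearestEven x n → m ≡ n
isNearestEven-unique {x} {m} {n} P Q with ℤP.<-cmp m n
... | tri≈ _ m≡n _ = m≡n
-- The two bounds force `n` to be `m + 1`, the excluded case.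
... | tri< m<n _ _ = contradiction
  (subst (IsNearestEven x) (ℤP.≤-antisym (isNearestEven-≤1+ Q P) (i<j⇒i+1≤j m<n)) Q) (isNearestEven-≢1+ P)
... | tri> _ _ n<m = contradiction
  (subst (IsNearestEven x) (ℤP.≤-antisym (isNearestEven-≤1+ P Q) (i<j⇒i+1≤j n<m)) P) (isNearestEven-≢1+ Q)

isNearestEven-neg : ∀ {x n} → IsNearestEven x n → IsNearestEven (ℚ.- x) (ℤ.- n)
isNearestEven-neg {x} {n} P = record
  { lower     = subst (-½ ℚ.≤_) (sym flip) (ℚP.neg-antimono-≤ (upper P))
  ; upper     = subst (ℚ._≤ ½) (sym flip) (ℚP.neg-antimono-≤ (lower P))
  ; lower-tie = λ eq → even (upper-tie P (ℚP.neg-injective (trans (sym flip) eq)))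
  ; upper-tie = λ eq → even (lower-tie P (ℚP.neg-injective (trans (sym flip) eq)))
  }
  where
  open IsNearestEven
  even : 2 ∣ ℤ.∣ n ∣ → 2 ∣ ℤ.∣ ℤ.- n ∣
  even = subst (2 ∣_) (sym (ℤP.∣-i∣≡∣i∣ n))
  flip : ℚ.- x - ι (ℤ.- n) ≡ ℚ.- (x - ι n)
  flip = trans (cong (λ y → ℚ.- x - y) (ι-neg n))
    (solve 2 (λ x y → :- x :- :- y := :- (x :- y)) refl x (ι n))

rnd-neg : ∀ x → rnd (ℚ.- x) ≡ ℤ.- rnd x
rnd-neg x = isNearestEven-unique (rnd-isNearestEven (ℚ.- x)) (isNearestEven-neg (rnd-isNearestEven x))

-- If `rnd x` exceeded `n`, it would be at least 1 above `x`, whereas the residue is never below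
-- `-½`.
rnd-≤ : ∀ {x} n → x ℚ.≤ ι n → rnd x ℤ.≤ n
rnd-≤ {x} n x≤n = ℤP.≮⇒≥ λ n<r → ℚP.<-irrefl refl (begin-strict
    -½                            ≤⟨ lower (rnd-isNearestEven x) ⟩
    x - ι (rnd x)                 ≤⟨ ℚP.+-mono-≤ x≤n (ℚP.neg-antimono-≤ (ι-mono-≤ (ℤP.i<j⇒suc[i]≤j n<r))) ⟩
    ι n - ι (+ 1 ℤ.+ n)           ≡⟨ cong (λ y → ι n - y) (ι-+ (+ 1) n) ⟩
    ι n - (1ℚ + ι n)              ≡⟨ solve 1 (λ n → n :- (con 1ℚ :+ n) := con (ℚ.- 1ℚ)) refl (ι n) ⟩
    ℚ.- 1ℚ                        <⟨ ℚ.*<* (ℤ.-<- (ℕ.s≤s ℕ.z≤n)) ⟩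
    -½                            ∎)
  where
  open ℚP.≤-Reasoning
  open IsNearestEven

rnd-≥ : ∀ {x} n → ι n ℚ.≤ x → n ℤ.≤ rnd x
rnd-≥ {x} n n≤x = subst₂ ℤ._≤_ (ℤP.neg-involutive n) (ℤP.neg-involutive (rnd x))
  (ℤP.neg-mono-≤ (subst (ℤ._≤ ℤ.- n) (rnd-neg x)
    (rnd-≤ (ℤ.- n) (subst (ℚ.- x ℚ.≤_) (sym (ι-neg n)) (ℚP.neg-antimono-≤ n≤x)))))

-- Bounds for the binary logarithm.

2^⌊log₂n⌋≤n : ∀ n .{{_ : NonZero n}} → 2 ℕ.^ ⌊log₂ n ⌋ ℕ.≤ n
2^⌊log₂n⌋≤n = <-rec (λ n → .{{_ : NonZero n}} → 2 ℕ.^ ⌊log₂ n ⌋ ℕ.≤ n) step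
  where
  step : ∀ n → (∀ {m} → m ℕ.< n → .{{_ : NonZero m}} → 2 ℕ.^ ⌊log₂ m ⌋ ℕ.≤ m) →
         .{{_ : NonZero n}} → 2 ℕ.^ ⌊log₂ n ⌋ ℕ.≤ n
  step 1             _  = ℕP.≤-refl
  step n@(suc (suc k)) ih = begin
    -- Bounding the logarithm by 1 plus its truncated predecessor holds even for logarithm 0, so
    -- that case needs no separate treatment.
    2 ℕ.^ ⌊log₂ n ⌋                          ≤⟨ ℕP.^-monoʳ-≤ 2 (ℕP.m≤n+m∸n ⌊log₂ n ⌋ 1) ⟩
    2 ℕ.* 2 ℕ.^ (⌊log₂ n ⌋ ℕ.∸ 1)            ≡⟨ cong (λ l → 2 ℕ.* 2 ℕ.^ l) (⌊log₂⌊n/2⌋⌋≡⌊log₂n⌋∸1 n) ⟨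
    2 ℕ.* 2 ℕ.^ ⌊log₂ ℕ.⌊ n /2⌋ ⌋            ≤⟨ ℕP.*-monoʳ-≤ 2 (ih (ℕP.⌊n/2⌋<n (suc k))) ⟩
    2 ℕ.* ℕ.⌊ n /2⌋                          ≡⟨ cong (ℕ.⌊ n /2⌋ ℕ.+_) (ℕP.+-identityʳ ℕ.⌊ n /2⌋) ⟩
    ℕ.⌊ n /2⌋ ℕ.+ ℕ.⌊ n /2⌋                  ≤⟨ ℕP.+-monoʳ-≤ ℕ.⌊ n /2⌋ (ℕP.⌊n/2⌋≤⌈n/2⌉ n) ⟩
    ℕ.⌊ n /2⌋ ℕ.+ ℕ.⌈ n /2⌉                  ≡⟨ ℕP.⌊n/2⌋+⌈n/2⌉≡n n ⟩
    n                                        ∎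
    where open ℕP.≤-Reasoning

n<2^[1+⌊log₂n⌋] : ∀ n → n ℕ.< 2 ℕ.^ suc ⌊log₂ n ⌋
n<2^[1+⌊log₂n⌋] n = ℕP.≰⇒> λ 2^≤n → ℕP.<-irrefl refl
  (subst (ℕ._≤ ⌊log₂ n ⌋) (⌊log₂[2^n]⌋≡n (suc ⌊log₂ n ⌋)) (⌊log₂⌋-mono-≤ 2^≤n))

-- Bit vectors and the numbers they encode.

fromBits∘toBits : ∀ n k → fromBits (toBits n k) ≡ (k ℕ.% 2 ℕ.^ n) {{ℕP.m^n≢0 2 n}}
fromBits∘toBits zero    k = sym (ℕD.n%1≡0 k)
fromBits∘toBits (suc n) k = begin
  fromBits (toBits (suc n) k)                     ≡⟨ fromBits-∷ b refl ⟩
  b ℕ.* N ℕ.+ r                                   ≡⟨ ℕD.m<n⇒m%n≡m bN+r<2N ⟨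
  -- The bits above the leading one re-enter as a multiple of `2 * N`; together with `b` and `r`
  -- they rebuild `k`.
  (b ℕ.* N ℕ.+ r) ℕ.% (2 ℕ.* N)                   ≡⟨ ℕD.[m+kn]%n≡m%n (b ℕ.* N ℕ.+ r) (q ℕ./ 2) (2 ℕ.* N) ⟨
  (b ℕ.* N ℕ.+ r ℕ.+ q ℕ./ 2 ℕ.* (2 ℕ.* N)) ℕ.% (2 ℕ.* N) ≡⟨ cong (ℕ._% (2 ℕ.* N)) (identity b (q ℕ./ 2) N r) ⟩
  (r ℕ.+ (b ℕ.+ q ℕ./ 2 ℕ.* 2) ℕ.* N) ℕ.% (2 ℕ.* N)
    ≡⟨ cong (λ x → (r ℕ.+ x ℕ.* N) ℕ.% (2 ℕ.* N)) (ℕD.m≡m%n+[m/n]*n q 2) ⟨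
  (r ℕ.+ q ℕ.* N) ℕ.% (2 ℕ.* N)                   ≡⟨ cong (ℕ._% (2 ℕ.* N)) (ℕD.m≡m%n+[m/n]*n k N) ⟨
  k ℕ.% (2 ℕ.* N)                                 ∎
  where
  open ≡-Reasoning
  instance
    N≢0 : NonZero (2 ℕ.^ n)
    N≢0 = ℕP.m^n≢0 2 n
    2N≢0 : NonZero (2 ℕ.* 2 ℕ.^ n)
    2N≢0 = ℕP.m^n≢0 2 (suc n)
  N q b r : ℕ
  N = 2 ℕ.^ n
  q = k ℕ./ N
  b = q ℕ.% 2
  r = k ℕ.% N

  identity : ∀ b h N r → b ℕ.* N ℕ.+ r ℕ.+ h ℕ.* (2 ℕ.* N) ≡ r ℕ.+ (b ℕ.+ h ℕ.* 2) ℕ.* N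
  identity = ℕS.solve-∀

  bN+r<2N : b ℕ.* N ℕ.+ r ℕ.< 2 ℕ.* N
  bN+r<2N = ℕP.<-≤-trans (ℕP.+-monoʳ-< (b ℕ.* N) (ℕD.m%n<n k N))
    (subst (ℕ._≤ 2 ℕ.* N) (ℕP.+-comm N (b ℕ.* N)) (ℕP.*-monoˡ-≤ N (ℕD.m%n<n q 2)))

  -- The bit is a fresh variable tied by an equation, so that it can be matched on; values above 1
  -- are not remainders modulo 2.
  fromBits-∷ : ∀ b → b ≡ q ℕ.% 2 → fromBits ((b ℕ.≡ᵇ 1) ∷ toBits n k) ≡ b ℕ.* N ℕ.+ r
  fromBits-∷ 0             _  = fromBits∘toBits n k
  fromBits-∷ 1             _  = cong₂ ℕ._+_ (sym (ℕP.+-identityʳ N)) (fromBits∘toBits n k)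
  fromBits-∷ (suc (suc b)) eq = contradiction (subst (ℕ._< 2) (sym eq) (ℕD.m%n<n q 2))
    λ { (ℕ.s≤s (ℕ.s≤s ())) }

fromBits∘toBits-< : ∀ {n k} → k ℕ.< 2 ℕ.^ n → fromBits (toBits n k) ≡ k
fromBits∘toBits-< {n} {k} k<2^n = trans (fromBits∘toBits n k) (ℕD.m<n⇒m%n≡m {{ℕP.m^n≢0 2 n}} k<2^n)

module _ {A : Set} where
  take-++ : ∀ {m n} (xs : Vec A m) (ys : Vec A n) → take m (xs ++ ys) ≡ xs
  take-++ []       ys = refl
  take-++ (x ∷ xs) ys = cong (x ∷_) (take-++ xs ys)

  drop-++ : ∀ {m n} (xs : Vec A m) (ys : Vec A n) → drop m (xs ++ ys) ≡ ys
  drop-++ []       ys = refl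
  drop-++ (x ∷ xs) ys = drop-++ xs ys

-- Exactness of the dyadic operations.

signed-not : ∀ s m → signed (not s) m ≡ ℤ.- signed s m
signed-not false m = refl
signed-not true  m = sym (ℤP.neg-involutive (+ m))

signed-xor : ∀ s t m n → signed (s xor t) (m ℕ.* n) ≡ signed s m ℤ.* signed t n
signed-xor false false m n = ℤP.pos-* m n
signed-xor false true  m n = trans (cong ℤ.-_ (ℤP.pos-* m n)) (ℤP.neg-distribʳ-* (+ m) (+ n))
signed-xor true  false m n = trans (cong ℤ.-_ (ℤP.pos-* m n)) (ℤP.neg-distribˡ-* (+ m) (+ n))
signed-xor true  true  m n = trans (ℤP.pos-* m n) (identity (+ m) (+ n))
  where
  identity : ∀ i j → i ℤ.* j ≡ (ℤ.- i) ℤ.* (ℤ.- j)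
  identity = ℤS.solve-∀

-- The default sign is consulted only at 0, where both signs give 0; hence the rule for the sign of
-- an exact zero does not affect values.
signed-signBit : ∀ i s → signed (signBit i s) ℤ.∣ i ∣ ≡ i
signed-signBit (+ 0)    false = refl
signed-signBit (+ 0)    true  = refl
signed-signBit +[1+ _ ] _     = refl
signed-signBit -[1+ _ ] _     = refl

signed-*ʳ : ∀ s m n → signed s (m ℕ.* n) ≡ signed s m ℤ.* + n
signed-*ʳ false m n = ℤP.pos-* m n
signed-*ʳ true  m n = trans (cong ℤ.-_ (ℤP.pos-* m n)) (ℤP.neg-distribˡ-* (+ m) (+ n))

⟦⟧-neg : ∀ d → ⟦ -ᵈ d ⟧ ≡ ℚ.- ⟦ d ⟧
⟦⟧-neg (dyadic s m q) = begin
  ι (signed (not s) m) * 2^ q     ≡⟨ cong (λ i → ι i * 2^ q) (signed-not s m) ⟩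
  ι (ℤ.- signed s m) * 2^ q       ≡⟨ cong (_* 2^ q) (ι-neg (signed s m)) ⟩
  ℚ.- ι (signed s m) * 2^ q       ≡⟨ ℚP.neg-distribˡ-* (ι (signed s m)) (2^ q) ⟨
  ℚ.- (ι (signed s m) * 2^ q)     ∎
  where open ≡-Reasoning

⟦⟧-* : ∀ d e → ⟦ d *ᵈ e ⟧ ≡ ⟦ d ⟧ * ⟦ e ⟧
⟦⟧-* (dyadic s m q) (dyadic t n r) = begin
  ι (signed (s xor t) (m ℕ.* n)) * 2^ (q ℤ.+ r)    ≡⟨ cong₂ _*_ (cong ι (signed-xor s t m n)) (2^-homo-* q r) ⟩
  ι (signed s m ℤ.* signed t n) * (2^ q * 2^ r)    ≡⟨ cong (_* (2^ q * 2^ r)) (ι-* (signed s m) (signed t n)) ⟩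
  ι (signed s m) * ι (signed t n) * (2^ q * 2^ r)
    ≡⟨ interchange (ι (signed s m)) (ι (signed t n)) (2^ q) (2^ r) ⟩
  ι (signed s m) * 2^ q * (ι (signed t n) * 2^ r)  ∎
  where open ≡-Reasoning

⟦⟧-shift : ∀ s m n q → ⟦ dyadic s (m ℕ.* 2 ℕ.^ n) q ⟧ ≡ ⟦ dyadic s m (+ n ℤ.+ q) ⟧
⟦⟧-shift s m n q = begin
  ι (signed s (m ℕ.* 2 ℕ.^ n)) * 2^ q            ≡⟨ cong (λ i → ι i * 2^ q) (signed-*ʳ s m (2 ℕ.^ n)) ⟩
  ι (signed s m ℤ.* + (2 ℕ.^ n)) * 2^ q          ≡⟨ cong (_* 2^ q) (ι-* (signed s m) (+ (2 ℕ.^ n))) ⟩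
  ι (signed s m) * ι (+ (2 ℕ.^ n)) * 2^ q        ≡⟨ ℚP.*-assoc (ι (signed s m)) (ι (+ (2 ℕ.^ n))) (2^ q) ⟩
  ι (signed s m) * (ι (+ (2 ℕ.^ n)) * 2^ q)      ≡⟨ cong (λ x → ι (signed s m) * (x * 2^ q)) (2^-ι n) ⟨
  ι (signed s m) * (2^ (+ n) * 2^ q)             ≡⟨ cong (ι (signed s m) *_) (2^-homo-* (+ n) q) ⟨
  ι (signed s m) * 2^ (+ n ℤ.+ q)                ∎
  where open ≡-Reasoning

-- Lowering an exponent is an exact shift of the significand; `r ≤ q` ensures that the absolute
-- value in the shift is `q - r` itself.
⟦⟧-align : ∀ s m {q r} → r ℤ.≤ q → ⟦ dyadic s (m ℕ.* 2 ℕ.^ ℤ.∣ q ℤ.- r ∣) r ⟧ ≡ ⟦ dyadic s m q ⟧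
⟦⟧-align s m {q} {r} r≤q = begin
  ⟦ dyadic s (m ℕ.* 2 ℕ.^ ℤ.∣ q ℤ.- r ∣) r ⟧     ≡⟨ ⟦⟧-shift s m ℤ.∣ q ℤ.- r ∣ r ⟩
  ⟦ dyadic s m (+ ℤ.∣ q ℤ.- r ∣ ℤ.+ r) ⟧
    ≡⟨ cong (λ i → ⟦ dyadic s m (i ℤ.+ r) ⟧) (ℤP.0≤i⇒+∣i∣≡i (ℤP.i≤j⇒0≤j-i r≤q)) ⟩
  ⟦ dyadic s m (q ℤ.- r ℤ.+ r) ⟧                 ≡⟨ cong (λ i → ⟦ dyadic s m i ⟧) (i-j+j≡i q r) ⟩
  ⟦ dyadic s m q ⟧                               ∎
  where open ≡-Reasoning

⟦⟧-+ : ∀ d e → ⟦ d +ᵈ e ⟧ ≡ ⟦ d ⟧ + ⟦ e ⟧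
⟦⟧-+ (dyadic s₁ m₁ q₁) (dyadic s₂ m₂ q₂) = begin
  ι (signed (signBit (n₁ ℤ.+ n₂) (s₁ ∧ s₂)) ℤ.∣ n₁ ℤ.+ n₂ ∣) * 2^ q
    ≡⟨ cong (λ i → ι i * 2^ q) (signed-signBit (n₁ ℤ.+ n₂) (s₁ ∧ s₂)) ⟩
  ι (n₁ ℤ.+ n₂) * 2^ q          ≡⟨ cong (_* 2^ q) (ι-+ n₁ n₂) ⟩
  (ι n₁ + ι n₂) * 2^ q          ≡⟨ ℚP.*-distribʳ-+ (2^ q) (ι n₁) (ι n₂) ⟩
  ι n₁ * 2^ q + ι n₂ * 2^ q
    ≡⟨ cong₂ _+_ (⟦⟧-align s₁ m₁ (ℤP.i⊓j≤i q₁ q₂)) (⟦⟧-align s₂ m₂ (ℤP.i⊓j≤j q₁ q₂)) ⟩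
  ⟦ dyadic s₁ m₁ q₁ ⟧ + ⟦ dyadic s₂ m₂ q₂ ⟧ ∎
  where
  open ≡-Reasoning
  q n₁ n₂ : ℤ
  q  = q₁ ℤ.⊓ q₂
  n₁ = signed s₁ (m₁ ℕ.* 2 ℕ.^ ℤ.∣ q₁ ℤ.- q ∣)
  n₂ = signed s₂ (m₂ ℕ.* 2 ℕ.^ ℤ.∣ q₂ ℤ.- q ∣)

-- Magnitude, scaling and binade of a dyadic.

0≤m2^q : ∀ m q → 0ℚ ℚ.≤ ι (+ m) * 2^ q
0≤m2^q m q = ℚP.nonNegative⁻¹ (ι (+ m) * 2^ q)
  {{ℚP.nonNeg*nonNeg⇒nonNeg (ι (+ m)) {{ι-nonNeg m}} (2^ q) {{ℚP.pos⇒nonNeg (2^ q) {{2^-pos q}}}}}}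

∣⟦⟧∣ : ∀ s m q → ℚ.∣ ⟦ dyadic s m q ⟧ ∣ ≡ ι (+ m) * 2^ q
∣⟦⟧∣ false m q = ℚP.0≤p⇒∣p∣≡p (0≤m2^q m q)
∣⟦⟧∣ true  m q = trans (cong ℚ.∣_∣ (⟦⟧-neg (dyadic false m q)))
  (trans (ℚP.∣-p∣≡∣p∣ (ι (+ m) * 2^ q)) (∣⟦⟧∣ false m q))

rescale : ∀ x q c → x * 2^ q * 2^ (ℤ.- c) ≡ x * 2^ (q ℤ.- c)
rescale x q c = trans (ℚP.*-assoc x (2^ q) (2^ (ℤ.- c))) (cong (x *_) (sym (2^-homo-* q (ℤ.- c))))

-- A nonnegative number rounds to a nonnegative integer, so the absolute value changes nothing
-- there; oddness of `rnd` carries the sign through.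
rnd-⟦⟧ : ∀ s m q → rnd ⟦ dyadic s m q ⟧ ≡ signed s ℤ.∣ rnd (ι (+ m) * 2^ q) ∣
rnd-⟦⟧ false m q = sym (ℤP.0≤i⇒+∣i∣≡i (rnd-≥ (+ 0) (0≤m2^q m q)))
rnd-⟦⟧ true  m q = trans (cong rnd (⟦⟧-neg (dyadic false m q)))
  (trans (rnd-neg (ι (+ m) * 2^ q)) (cong ℤ.-_ (rnd-⟦⟧ false m q)))

module _ (m : ℕ) .{{_ : NonZero m}} (q : ℤ) where
  private
    l : ℤ
    l = + ⌊log₂ m ⌋ ℤ.+ q
    2^q≥0 : ℚ.NonNegative (2^ q)
    2^q≥0 = ℚP.pos⇒nonNeg (2^ q) {{2^-pos q}}

  2^l≤m2^q : 2^ l ℚ.≤ ι (+ m) * 2^ q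
  2^l≤m2^q = begin
    2^ l                           ≡⟨ 2^-homo-* (+ ⌊log₂ m ⌋) q ⟩
    2^ (+ ⌊log₂ m ⌋) * 2^ q        ≡⟨ cong (_* 2^ q) (2^-ι ⌊log₂ m ⌋) ⟩
    ι (+ (2 ℕ.^ ⌊log₂ m ⌋)) * 2^ q ≤⟨ ℚP.*-monoʳ-≤-nonNeg (2^ q) {{2^q≥0}}
                                        (ι-mono-≤ (ℤ.+≤+ (2^⌊log₂n⌋≤n m))) ⟩
    ι (+ m) * 2^ q                 ∎
    where open ℚP.≤-Reasoning

  m2^q<2^[l+1] : ι (+ m) * 2^ q ℚ.< 2^ (l ℤ.+ + 1)
  m2^q<2^[l+1] = begin-strict
    ι (+ m) * 2^ q                       <⟨ ℚP.*-monoˡ-<-pos (2^ q) {{2^-pos q}}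
                                              (ι-mono-< (ℤ.+<+ (n<2^[1+⌊log₂n⌋] m))) ⟩
    ι (+ (2 ℕ.^ suc ⌊log₂ m ⌋)) * 2^ q   ≡⟨ cong (_* 2^ q) (2^-ι (suc ⌊log₂ m ⌋)) ⟨
    2^ (+ suc ⌊log₂ m ⌋) * 2^ q          ≡⟨ 2^-homo-* (+ suc ⌊log₂ m ⌋) q ⟨
    2^ (+ 1 ℤ.+ + ⌊log₂ m ⌋ ℤ.+ q)       ≡⟨ cong 2^_ (identity (+ ⌊log₂ m ⌋) q) ⟩
    2^ (l ℤ.+ + 1)                       ∎
    where
    open ℚP.≤-Reasoning
    identity : ∀ i q → + 1 ℤ.+ i ℤ.+ q ≡ i ℤ.+ q ℤ.+ + 1
    identity = ℤS.solve-∀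

-- Rounding on the gradual-underflow grid.

module _ (F : Format) where
  open Format F

  module _ {m : ℕ} {q c j : ℤ} {n : ℕ} (j-c≡n : j ℤ.- c ≡ + n) where
    private
      2^-c≥0 : ℚ.NonNegative (2^ (ℤ.- c))
      2^-c≥0 = ℚP.pos⇒nonNeg (2^ (ℤ.- c)) {{2^-pos (ℤ.- c)}}

      2^j2^-c : 2^ j * 2^ (ℤ.- c) ≡ ι (+ (2 ℕ.^ n))
      2^j2^-c = trans (sym (2^-homo-* j (ℤ.- c))) (trans (cong 2^_ j-c≡n) (2^-ι n))

      +roundAt : + roundAt F m q c ≡ rnd (ι (+ m) * 2^ (q ℤ.- c))
      +roundAt = sym (rnd-⟦⟧ false m (q ℤ.- c))

    -- Scaling by `2^ (- c)` turns the bound `2^ j` into the integer `2 ^ n`, and integer bounds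
    -- survive rounding. The lower bound below works likewise.
    roundAt-≤ : ι (+ m) * 2^ q ℚ.≤ 2^ j → roundAt F m q c ℕ.≤ 2 ℕ.^ n
    roundAt-≤ le = ℤP.drop‿+≤+ (subst (ℤ._≤ + (2 ℕ.^ n)) (sym +roundAt)
      (rnd-≤ (+ (2 ℕ.^ n)) (subst₂ ℚ._≤_ (rescale (ι (+ m)) q c) 2^j2^-c
        (ℚP.*-monoʳ-≤-nonNeg (2^ (ℤ.- c)) {{2^-c≥0}} le))))

    roundAt-≥ : 2^ j ℚ.≤ ι (+ m) * 2^ q → 2 ℕ.^ n ℕ.≤ roundAt F m q c
    roundAt-≥ le = ℤP.drop‿+≤+ (subst (+ (2 ℕ.^ n) ℤ.≤_) (sym +roundAt)
      (rnd-≥ (+ (2 ℕ.^ n)) (subst₂ ℚ._≤_ 2^j2^-c (rescale (ι (+ m)) q c)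
        (ℚP.*-monoʳ-≤-nonNeg (2^ (ℤ.- c)) {{2^-c≥0}} le))))

  -- `R` uses the exponent returned by a search; uniqueness of the bracket allows any other
  -- bracketing exponent in its place. Zero is excluded because `2^ (e - 1)` is positive.
  R-bracket : ∀ {x} e → 2^ (e ℤ.- + 1) ℚ.≤ ℚ.∣ x ∣ → ℚ.∣ x ∣ ℚ.< 2^ e →
              let c = (e ℤ.- + precision) ℤ.⊔ eₘᵢₙ in
              R F x ≡ ι (rnd (x * 2^ (ℤ.- c))) * 2^ c
  R-bracket {x} e lo hi with x ℚP.≟ 0ℚ
  ... | yes refl = contradiction refl (ℚP.<⇒≢ (ℚP.<-≤-trans
     (ℚP.positive⁻¹ (2^ (e ℤ.- + 1)) {{2^-pos (e ℤ.- + 1)}}) lo))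
  ... | no x≢0 = cong (λ e → let c = (e ℤ.- + precision) ℤ.⊔ eₘᵢₙ in ι (rnd (x * 2^ (ℤ.- c))) * 2^ c)
    (ℤP.≤-antisym (binaryExponent-≤ e′ e lo′ hi) (binaryExponent-≤ e e′ lo hi′))
    where
    e′  = proj₁ (binaryExponent x x≢0)
    lo′ = proj₁ (proj₂ (binaryExponent x x≢0))
    hi′ = proj₂ (proj₂ (binaryExponent x x≢0))

  -- The bracketing exponent is `l + 1`, and its extra 1 cancels against the one in `precision`,
  -- leaving `l - fʷ`.
  R-⟦⟧ : ∀ s m .{{_ : NonZero m}} q →
         let c = (+ ⌊log₂ m ⌋ ℤ.+ q ℤ.- + fʷ) ℤ.⊔ eₘᵢₙ in
         R F ⟦ dyadic s m q ⟧ ≡ ⟦ dyadic s (roundAt F m q c) c ⟧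
  R-⟦⟧ s m q = begin
    R F ⟦ dyadic s m q ⟧
      ≡⟨ R-bracket (l ℤ.+ + 1) (subst₂ ℚ._≤_ (cong 2^_ (sym (i+1-1 l))) (sym (∣⟦⟧∣ s m q)) (2^l≤m2^q m q))
                   (subst (ℚ._< 2^ (l ℤ.+ + 1)) (sym (∣⟦⟧∣ s m q)) (m2^q<2^[l+1] m q)) ⟩
    rounded ((l ℤ.+ + 1 ℤ.- + precision) ℤ.⊔ eₘᵢₙ)
      ≡⟨ cong (λ i → rounded (i ℤ.⊔ eₘᵢₙ))
           (trans (cong (λ p → l ℤ.+ + 1 ℤ.- p) (ℤP.pos-+ fʷ 1)) (identity l (+ fʷ))) ⟩
    rounded c
      ≡⟨ cong (λ x → ι (rnd x) * 2^ c) (rescale (ι (signed s m)) q c) ⟩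
    ι (rnd ⟦ dyadic s m (q ℤ.- c) ⟧) * 2^ c
      ≡⟨ cong (λ i → ι i * 2^ c) (rnd-⟦⟧ s m (q ℤ.- c)) ⟩
    ⟦ dyadic s (roundAt F m q c) c ⟧      ∎
    where
    open ≡-Reasoning
    l c : ℤ
    l = + ⌊log₂ m ⌋ ℤ.+ q
    c = (l ℤ.- + fʷ) ℤ.⊔ eₘᵢₙ
    rounded : ℤ → ℚ
    rounded c = ι (rnd (⟦ dyadic s m q ⟧ * 2^ (ℤ.- c))) * 2^ c
    i+1-1 : ∀ i → i ℤ.+ + 1 ℤ.- + 1 ≡ i
    i+1-1 = ℤS.solve-∀
    identity : ∀ l f → l ℤ.+ + 1 ℤ.- (f ℤ.+ + 1) ≡ l ℤ.- f
    identity = ℤS.solve-∀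

  -- Packed words and their values.

  1<maxField : 1 ℕ.< maxField
  -- `2≤eʷ` gives `4 ≤ 2 ^ eʷ`. Thus the exponent fields 0 and 1, both produced by subnormal
  -- packing, differ from the reserved one.
  1<maxField = ℕP.∸-monoˡ-≤ 1 (ℕP.<⇒≤ (ℕP.^-monoʳ-≤ 2 2≤eʷ))

  -- This ties the overflow test to the encoding: an exponent at most `bias` has a field at most
  -- `bias + bias`, one less than the reserved field.
  +maxField : + maxField ≡ + 1 ℤ.+ (bias ℤ.+ bias)
  +maxField = begin
    + (2 ℕ.^ eʷ ℕ.∸ 1)                            ≡⟨ ℤP.⊖-≥ (ℕP.m^n>0 2 eʷ) ⟨
    2 ℕ.^ eʷ ℤ.⊖ 1                                ≡⟨ ℤP.[+m]-[+n]≡m⊖n (2 ℕ.^ eʷ) 1 ⟨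
    + (2 ℕ.^ eʷ) ℤ.- + 1
      ≡⟨ cong (λ e → + (2 ℕ.^ e) ℤ.- + 1) (ℕP.m+[n∸m]≡n (ℕP.<⇒≤ 2≤eʷ)) ⟨
    + (2 ℕ.* 2 ℕ.^ (eʷ ℕ.∸ 1)) ℤ.- + 1            ≡⟨ cong (ℤ._- + 1) (ℤP.pos-* 2 (2 ℕ.^ (eʷ ℕ.∸ 1))) ⟩
    + 2 ℤ.* + (2 ℕ.^ (eʷ ℕ.∸ 1)) ℤ.- + 1          ≡⟨ identity (+ (2 ℕ.^ (eʷ ℕ.∸ 1))) ⟩
    + 1 ℤ.+ (bias ℤ.+ bias)                       ∎
    where
    open ≡-Reasoning
    identity : ∀ B → + 2 ℤ.* B ℤ.- + 1 ≡ + 1 ℤ.+ ((B ℤ.- + 1) ℤ.+ (B ℤ.- + 1))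
    identity = ℤS.solve-∀

  maxField<2^eʷ : maxField ℕ.< 2 ℕ.^ eʷ
  maxField<2^eʷ = ℕP.∸-monoʳ-< (ℕ.s≤s ℕ.z≤n) (ℕP.m^n>0 2 eʷ)

  exponentField-pack : ∀ s {E} M → E ℕ.< 2 ℕ.^ eʷ → exponentField F (pack F s E M) ≡ E
  exponentField-pack s {E} M E<2^e =
    trans (cong fromBits (take-++ (toBits eʷ E) (toBits fʷ M))) (fromBits∘toBits-< {eʷ} E<2^e)

  fractionField-pack : ∀ s E {M} → M ℕ.< 2 ℕ.^ fʷ → fractionField F (pack F s E M) ≡ M
  fractionField-pack s E {M} M<2^f =
    trans (cong fromBits (drop-++ (toBits eʷ E) (toBits fʷ M))) (fromBits∘toBits-< {fʷ} M<2^f)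

  decode-finite : ∀ w → Finite F w →
                  decode F w ≡ finite (decodeFinite F (signField F w) (exponentField F w) (fractionField F w))
  decode-finite w w-finite with exponentField F w ℕ.≟ maxField
  ... | no  _   = refl
  ... | yes E≡max = contradiction E≡max w-finite

  val-decode : ∀ {w d} → decode F w ≡ finite d → val F w ≡ ⟦ d ⟧
  val-decode eq rewrite eq = refl

  val-pack : ∀ s {E M} → E ℕ.< maxField → M ℕ.< 2 ℕ.^ fʷ → val F (pack F s E M) ≡ ⟦ decodeFinite F s E M ⟧
  val-pack s {E} {M} E<max M<2^f = begin
    val F w
      ≡⟨ val-decode {w} (decode-finite w λ eq → ℕP.<⇒≢ E<max (trans (sym E≡) eq)) ⟩
    ⟦ decodeFinite F s (exponentField F w) (fractionField F w) ⟧
      ≡⟨ cong₂ (λ E M → ⟦ decodeFinite F s E M ⟧) E≡ (fractionField-pack s E M<2^f) ⟩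
    ⟦ decodeFinite F s E M ⟧ ∎
    where
    open ≡-Reasoning
    w : Word F
    w = pack F s E M
    E≡ : exponentField F w ≡ E
    E≡ = exponentField-pack s M (ℕP.<-trans E<max maxField<2^eʷ)

  infinity-nonfinite : ∀ s → ¬ Finite F (infinity F s)
  infinity-nonfinite s inf-finite = inf-finite (exponentField-pack s 0 maxField<2^eʷ)

  -- `decodeFinite` reduces only on a literal successor, whereas the packed field is an absolute
  -- value known merely to be positive.
  decodeFinite-normal : ∀ s {E} M → 0 ℕ.< E →
                        decodeFinite F s E M ≡ dyadic s (2 ℕ.^ fʷ ℕ.+ M) (+ E ℤ.- bias ℤ.- + fʷ)
  decodeFinite-normal s {suc E} M _ = refl

  val-packSubnormal : ∀ s {k} → k ℕ.≤ 2 ℕ.^ fʷ → val F (packSubnormal F s k) ≡ ⟦ dyadic s k eₘᵢₙ ⟧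
  val-packSubnormal s {k} k≤2^f with k ℕ.<ᵇ 2 ℕ.^ fʷ in eq
  ... | true  = val-pack s (ℕP.<-trans (ℕ.s≤s ℕ.z≤n) 1<maxField) (ℕP.<ᵇ⇒< k (2 ℕ.^ fʷ) (subst T (sym eq) tt))
  -- The fields (1, 0) denote 2 ^ fʷ at the same exponent eₘᵢₙ as the subnormals.
  ... | false = trans (val-pack s 1<maxField (ℕP.m^n>0 2 fʷ)) (cong (λ k → ⟦ dyadic s k eₘᵢₙ ⟧)
    (trans (ℕP.+-identityʳ (2 ℕ.^ fʷ)) (sym k≡2^f)))
    where
    k≡2^f : k ≡ 2 ℕ.^ fʷ
    k≡2^f = ℕP.≤-antisym k≤2^f (ℕP.≮⇒≥ λ k<2^f → subst T eq (ℕP.<⇒<ᵇ k<2^f))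

  val-packNormal : ∀ s {k l} → 2 ℕ.^ fʷ ℕ.≤ k → k ℕ.< 2 ℕ.^ (fʷ ℕ.+ 1) → + 1 ℤ.- bias ℤ.≤ l →
                   Finite F (packNormal F s k l) → val F (packNormal F s k l) ≡ ⟦ dyadic s k (l ℤ.- + fʷ) ⟧
  val-packNormal s {k} {l} 2^f≤k k<2^[f+1] 1-b≤l packed-finite with bias ℤ.<? l
  ... | yes _   = contradiction packed-finite (infinity-nonfinite s)
  ... | no  b≮l = begin
    val F (pack F s E (k ℕ.∸ 2 ℕ.^ fʷ))          ≡⟨ val-pack s E<max k-2^f<2^f ⟩
    ⟦ decodeFinite F s E (k ℕ.∸ 2 ℕ.^ fʷ) ⟧      ≡⟨ cong ⟦_⟧ (decodeFinite-normal s (k ℕ.∸ 2 ℕ.^ fʷ) 0<E) ⟩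
    ⟦ dyadic s (2 ℕ.^ fʷ ℕ.+ (k ℕ.∸ 2 ℕ.^ fʷ)) (+ E ℤ.- bias ℤ.- + fʷ) ⟧
      ≡⟨ cong₂ (λ k l → ⟦ dyadic s k (l ℤ.- + fʷ) ⟧) (ℕP.m+[n∸m]≡n 2^f≤k)
           (trans (cong (ℤ._- bias) +E) (i+j-j≡i l bias)) ⟩
    ⟦ dyadic s k (l ℤ.- + fʷ) ⟧                  ∎
    where
    open ≡-Reasoning
    E : ℕ
    E = ℤ.∣ l ℤ.+ bias ∣
    i+j-j≡i : ∀ i j → i ℤ.+ j ℤ.- j ≡ i
    i+j-j≡i = ℤS.solve-∀
    -- Positivity serves twice: the absolute value in `E` is harmless, and the field selects the
    -- normal decoding.
    1≤l+b : + 1 ℤ.≤ l ℤ.+ bias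
    1≤l+b = subst (ℤ._≤ l ℤ.+ bias) (i-j+j≡i (+ 1) bias) (ℤP.+-monoˡ-≤ bias 1-b≤l)
    +E : + E ≡ l ℤ.+ bias
    +E = ℤP.0≤i⇒+∣i∣≡i (ℤP.≤-trans (ℤ.+≤+ ℕ.z≤n) 1≤l+b)
    0<E : 0 ℕ.< E
    0<E = ℤP.drop‿+≤+ (subst (+ 1 ℤ.≤_) (sym +E) 1≤l+b)
    E<max : E ℕ.< maxField
    E<max = ℤP.drop‿+≤+ (subst₂ ℤ._≤_ (cong ℤ.suc (sym +E)) (sym +maxField)
      (ℤP.+-monoʳ-≤ (+ 1) (ℤP.+-monoˡ-≤ bias (ℤP.≮⇒≥ b≮l))))
    k-2^f<2^f : k ℕ.∸ 2 ℕ.^ fʷ ℕ.< 2 ℕ.^ fʷ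
    k-2^f<2^f = ℕP.+-cancelˡ-< (2 ℕ.^ fʷ) (k ℕ.∸ 2 ℕ.^ fʷ) (2 ℕ.^ fʷ)
      (subst₂ ℕ._<_ (sym (ℕP.m+[n∸m]≡n 2^f≤k))
        (trans (cong (2 ℕ.^_) (ℕP.+-comm fʷ 1)) (cong (2 ℕ.^ fʷ ℕ.+_) (ℕP.+-identityʳ (2 ℕ.^ fʷ)))) k<2^[f+1])

  -- On a carry `k` is `2 ^ (fʷ + 1)`; one factor 2 moves from the significand into the exponent,
  -- which only grows and so stays in the normal range.
  val-carryNormal : ∀ s {k l} → 2 ℕ.^ fʷ ℕ.≤ k → k ℕ.≤ 2 ℕ.^ (fʷ ℕ.+ 1) → + 1 ℤ.- bias ℤ.≤ l →
                    Finite F (carryNormal F s k l) → val F (carryNormal F s k l) ≡ ⟦ dyadic s k (l ℤ.- + fʷ) ⟧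
  val-carryNormal s {k} {l} 2^f≤k k≤2^[f+1] 1-b≤l carried-finite with k ℕ.≡ᵇ 2 ℕ.^ (fʷ ℕ.+ 1) in eq
  ... | false = val-packNormal s 2^f≤k
    (ℕP.≤∧≢⇒< k≤2^[f+1] λ k≡ → subst T eq (ℕP.≡⇒≡ᵇ k (2 ℕ.^ (fʷ ℕ.+ 1)) k≡)) 1-b≤l carried-finite
  ... | true  = begin
    val F (packNormal F s (2 ℕ.^ fʷ) (l ℤ.+ + 1))
      ≡⟨ val-packNormal s ℕP.≤-refl (ℕP.^-monoʳ-< 2 (ℕ.s≤s (ℕ.s≤s ℕ.z≤n)) (ℕP.m<m+n fʷ (ℕ.s≤s ℕ.z≤n)))
           (ℤP.≤-trans 1-b≤l (ℤP.i≤i+j l (+ 1))) carried-finite ⟩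
    ⟦ dyadic s (2 ℕ.^ fʷ) (l ℤ.+ + 1 ℤ.- + fʷ) ⟧
      ≡⟨ cong (λ i → ⟦ dyadic s (2 ℕ.^ fʷ) i ⟧) (identity l (+ fʷ)) ⟩
    ⟦ dyadic s (2 ℕ.^ fʷ) (+ 1 ℤ.+ (l ℤ.- + fʷ)) ⟧   ≡⟨ ⟦⟧-shift s (2 ℕ.^ fʷ) 1 (l ℤ.- + fʷ) ⟨
    ⟦ dyadic s (2 ℕ.^ fʷ ℕ.* 2 ℕ.^ 1) (l ℤ.- + fʷ) ⟧
      ≡⟨ cong (λ k → ⟦ dyadic s k (l ℤ.- + fʷ) ⟧) (trans (sym (ℕP.^-distribˡ-+-* 2 fʷ 1))
           (sym (ℕP.≡ᵇ⇒≡ k (2 ℕ.^ (fʷ ℕ.+ 1)) (subst T (sym eq) tt)))) ⟩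
    ⟦ dyadic s k (l ℤ.- + fʷ) ⟧                      ∎
    where
    open ≡-Reasoning
    identity : ∀ l f → l ℤ.+ + 1 ℤ.- f ≡ + 1 ℤ.+ (l ℤ.- f)
    identity = ℤS.solve-∀

  -- Agreement of `roundDyadic` with `R`.

  i-[i-j]≡j : ∀ i j → i ℤ.- (i ℤ.- j) ≡ j
  i-[i-j]≡j = ℤS.solve-∀

  [i+1]-[i-j]≡j+1 : ∀ i j → i ℤ.+ + 1 ℤ.- (i ℤ.- j) ≡ j ℤ.+ + 1
  [i+1]-[i-j]≡j+1 = ℤS.solve-∀

  module _ (s : Bool) (m : ℕ) .{{_ : NonZero m}} (q : ℤ) where
    private
      l : ℤ
      l = + ⌊log₂ m ⌋ ℤ.+ q

    R-subnormal : l ℤ.< + 1 ℤ.- bias →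
                  val F (packSubnormal F s (roundAt F m q eₘᵢₙ)) ≡ R F ⟦ dyadic s m q ⟧
    R-subnormal l<1-b = begin
      val F (packSubnormal F s (roundAt F m q eₘᵢₙ))
        -- The magnitude is below `2^ (l + 1)`, hence below `2^ (1 - bias)`, which lies `fʷ` binary
        -- places above the grid unit; so the rounded significand is at most `2 ^ fʷ`.
        ≡⟨ val-packSubnormal s (roundAt-≤ {m} {q} {j = + 1 ℤ.- bias} (i-[i-j]≡j (+ 1 ℤ.- bias) (+ fʷ))
             (ℚP.<⇒≤ (ℚP.<-≤-trans (m2^q<2^[l+1] m q) (2^-mono-≤ (i<j⇒i+1≤j l<1-b))))) ⟩
      ⟦ dyadic s (roundAt F m q eₘᵢₙ) eₘᵢₙ ⟧
        ≡⟨ cong (λ c → ⟦ dyadic s (roundAt F m q c) c ⟧)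
             (ℤP.i≤j⇒i⊔j≡j (ℤP.+-monoˡ-≤ (ℤ.- + fʷ) (ℤP.<⇒≤ l<1-b))) ⟨
      ⟦ dyadic s (roundAt F m q c) c ⟧      ≡⟨ R-⟦⟧ s m q ⟨
      R F ⟦ dyadic s m q ⟧                  ∎
      where
      open ≡-Reasoning
      c : ℤ
      c = (l ℤ.- + fʷ) ℤ.⊔ eₘᵢₙ

    R-normal : + 1 ℤ.- bias ℤ.≤ l → let w = carryNormal F s (roundAt F m q (l ℤ.- + fʷ)) l in
               Finite F w → val F w ≡ R F ⟦ dyadic s m q ⟧
    R-normal 1-b≤l rounded-finite = begin
      val F (carryNormal F s (roundAt F m q (l ℤ.- + fʷ)) l)
        -- The ends of the binade, `2^ l` and `2^ (l + 1)`, scale to `2 ^ fʷ` and `2 ^ (fʷ + 1)`;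
        -- the upper one can be reached by rounding.
        ≡⟨ val-carryNormal s (roundAt-≥ {m} {q} {j = l} (i-[i-j]≡j l (+ fʷ)) (2^l≤m2^q m q))
             (roundAt-≤ {m} {q} {j = l ℤ.+ + 1} ([i+1]-[i-j]≡j+1 l (+ fʷ)) (ℚP.<⇒≤ (m2^q<2^[l+1] m q)))
             1-b≤l rounded-finite ⟩
      ⟦ dyadic s (roundAt F m q (l ℤ.- + fʷ)) (l ℤ.- + fʷ) ⟧
        ≡⟨ cong (λ c → ⟦ dyadic s (roundAt F m q c) c ⟧)
             (ℤP.i≥j⇒i⊔j≡i (ℤP.+-monoˡ-≤ (ℤ.- + fʷ) 1-b≤l)) ⟨
      ⟦ dyadic s (roundAt F m q c) c ⟧      ≡⟨ R-⟦⟧ s m q ⟨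
      R F ⟦ dyadic s m q ⟧                  ∎
      where
      open ≡-Reasoning
      c : ℤ
      c = (l ℤ.- + fʷ) ℤ.⊔ eₘᵢₙ

    -- The decision is an argument since a `with` on it would unfold R and ⌊log₂_⌋, which is very slow.
    val-rounded : (l<1-b? : Dec (l ℤ.< + 1 ℤ.- bias)) →
                  let w = if does l<1-b? then packSubnormal F s (roundAt F m q eₘᵢₙ)
                          else carryNormal F s (roundAt F m q (l ℤ.- + fʷ)) l in
                  Finite F w → val F w ≡ R F ⟦ dyadic s m q ⟧
    val-rounded (yes l<1-b) _ = R-subnormal l<1-b
    val-rounded (no  l≮1-b) = R-normal (ℤP.≮⇒≥ l≮1-b)

  val-roundDyadic : ∀ d → Finite F (roundDyadic F d) → val F (roundDyadic F d) ≡ R F ⟦ d ⟧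
  val-roundDyadic (dyadic s zero q) _ = begin
    val F (pack F s 0 0)      ≡⟨ val-pack s (ℕP.<-trans (ℕ.s≤s ℕ.z≤n) 1<maxField) (ℕP.m^n>0 2 fʷ) ⟩
    -- Both signed zeros denote `0ℚ`, and `R F 0ℚ` computes to `0ℚ`.
    ⟦ dyadic s 0 eₘᵢₙ ⟧       ≡⟨ ⟦dyadic-0⟧ s eₘᵢₙ ⟩
    R F 0ℚ                    ≡⟨ cong (R F) (⟦dyadic-0⟧ s q) ⟨
    R F ⟦ dyadic s 0 q ⟧      ∎
    where
    open ≡-Reasoning
    ⟦dyadic-0⟧ : ∀ s q → ⟦ dyadic s 0 q ⟧ ≡ 0ℚ
    ⟦dyadic-0⟧ false q = ℚP.*-zeroˡ (2^ q)
    ⟦dyadic-0⟧ true  q = ℚP.*-zeroˡ (2^ q)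
  val-roundDyadic (dyadic s m@(suc _) q) =
    val-rounded s m q (+ ⌊log₂ m ⌋ ℤ.+ q ℤ.<? + 1 ℤ.- bias)

  -- The four reference operations.

  encode-correct : ∀ D d {x} → D ≡ finite d → ⟦ d ⟧ ≡ x → Finite F (encode F D) → val F (encode F D) ≡ R F x
  encode-correct _ d refl refl = val-roundDyadic d

theorem2 : (F : Format) (x y z : Word F) →
    (Finite F x → Finite F y → Finite F (S⁺ F x y) →
    val F (S⁺ F x y) ≡ R F (val F x + val F y))
    ×
    (Finite F x → Finite F y → Finite F (S⁻ F x y) →
    val F (S⁻ F x y) ≡ R F (val F x - val F y))
    ×
    (Finite F x → Finite F y → Finite F (S× F x y) →
    val F (S× F x y) ≡ R F (val F x * val F y))
    ×
    (Finite F x → Finite F y → Finite F z → Finite F (Sᶠᵐᵃ F x y z) →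
    val F (Sᶠᵐᵃ F x y z) ≡ R F (val F x * val F y + val F z))
theorem2 F x y z = add , sub , mul , fma
  where
  ⟪_⟫ : Word F → Dyadic
  ⟪ w ⟫ = decodeFinite F (signField F w) (exponentField F w) (fractionField F w)

  decoded : ∀ {w} → Finite F w → decode F w ≡ finite ⟪ w ⟫
  decoded {w} = decode-finite F w

  valued : ∀ {w} → Finite F w → ⟦ ⟪ w ⟫ ⟧ ≡ val F w
  valued {w} w-finite = sym (val-decode F {w} (decoded w-finite))

  add : Finite F x → Finite F y → Finite F (S⁺ F x y) → val F (S⁺ F x y) ≡ R F (val F x + val F y)
  add fx fy = encode-correct F (decode F x ⊕ decode F y) (⟪ x ⟫ +ᵈ ⟪ y ⟫)
    (cong₂ _⊕_ (decoded fx) (decoded fy))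
    (trans (⟦⟧-+ ⟪ x ⟫ ⟪ y ⟫) (cong₂ _+_ (valued fx) (valued fy)))

  sub : Finite F x → Finite F y → Finite F (S⁻ F x y) → val F (S⁻ F x y) ≡ R F (val F x - val F y)
  sub fx fy = encode-correct F (decode F x ⊕ (⊖ decode F y)) (⟪ x ⟫ +ᵈ (-ᵈ ⟪ y ⟫))
    (cong₂ (λ D E → D ⊕ (⊖ E)) (decoded fx) (decoded fy))
    -- Rational subtraction unfolds to addition of the negation, matching the dyadic side.
    (trans (⟦⟧-+ ⟪ x ⟫ (-ᵈ ⟪ y ⟫)) (cong₂ _+_ (valued fx) (trans (⟦⟧-neg ⟪ y ⟫) (cong ℚ.-_ (valued fy)))))

  ⟦xy⟧ : Finite F x → Finite F y → ⟦ ⟪ x ⟫ *ᵈ ⟪ y ⟫ ⟧ ≡ val F x * val F y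
  ⟦xy⟧ fx fy = trans (⟦⟧-* ⟪ x ⟫ ⟪ y ⟫) (cong₂ _*_ (valued fx) (valued fy))

  mul : Finite F x → Finite F y → Finite F (S× F x y) → val F (S× F x y) ≡ R F (val F x * val F y)
  mul fx fy = encode-correct F (decode F x ⊗ decode F y) (⟪ x ⟫ *ᵈ ⟪ y ⟫)
    (cong₂ _⊗_ (decoded fx) (decoded fy)) (⟦xy⟧ fx fy)

  fma : Finite F x → Finite F y → Finite F z → Finite F (Sᶠᵐᵃ F x y z) →
        val F (Sᶠᵐᵃ F x y z) ≡ R F (val F x * val F y + val F z)
  fma fx fy fz = encode-correct F ((decode F x ⊗ decode F y) ⊕ decode F z) ((⟪ x ⟫ *ᵈ ⟪ y ⟫) +ᵈ ⟪ z ⟫)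
    (cong₂ _⊕_ (cong₂ _⊗_ (decoded fx) (decoded fy)) (decoded fz))
    -- The product enters the sum as an exact dyadic, so only the final result is rounded.
    (trans (⟦⟧-+ (⟪ x ⟫ *ᵈ ⟪ y ⟫) ⟪ z ⟫) (cong₂ _+_ (⟦xy⟧ fx fy) (valued fz)))
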